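{- Let $\lambda,\mu,\nu$ be partitions with at most $3$ parts (written as triples $(\xi_1,\xi_2,\xi_3)$, $\xi_1\ge\xi_2\ge\xi_3\ge0$). Then the Littlewood–Richardson coefficient $c^{\lambda}_{\mu,\nu}$ (the coefficient of $s_\lambda$ in $s_\mu s_\nu$, Schur functions) equals $1$ if and only if $(\lambda,\mu,\nu)$ lies on a facet of the Horn cone $\mathcal{H}_3$, i.e. $|\lambda|=|\mu|+|\nu|$, all eighteen inequalities listed below hold, and at least one of them holds with equality.
   Context: The eighteen inequalities defining $\mathcal{H}_3$ (together with $|\lambda|=|\mu|+|\nu|$, where $|\xi|=\xi_1+\xi_2+\xi_3$) are: (1) $\mu_3\le\mu_2$; (2) $\mu_2\le\mu_1$; (3) $\nu_3\le\nu_2$; (4) $\nu_2\le\nu_1$; (5) $\lambda_3\le\lambda_2$; (6) $\lambda_2\le\lambda_1$; (7) $\lambda_1\le\mu_1+\nu_1$; (8) $\lambda_2\le\mu_1+\nu_2$; (9) $\lambda_2\le\mu_2+\nu_1$; (10) $\lambda_3\le\mu_1+\nu_3$; (11) $\lambda_3\le\mu_2+\nu_2$; (12) $\lambda_3\le\mu_3+\nu_1$; (13) $\lambda_3\ge\mu_3+\nu_3$; (14) $\lambda_2\ge\mu_3+\nu_2$; (15) $\lambda_2\ge\mu_2+\nu_3$; (16) $\lambda_1\ge\mu_3+\nu_1$; (17) $\lambda_1\ge\mu_2+\nu_2$; (18) $\lambda_1\ge\mu_1+\nu_3$. A facet is the set of points of $\mathcal{H}_3$ at which one of these inequalities is an equality.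 -}

module Defs where

open import Data.Fin as Fin using (Fin)
open import Data.Fin.Properties as Fin using ()
open import Data.Integer as ℤ using (ℤ; +_)
open import Data.List using (List; []; _∷_; length; map; filter; foldr; concat; zip; allFin; cartesianProductWith)
open import Data.List.Properties as List using ()
open import Data.List.Relation.Unary.All as All using (All)
open import Data.List.Relation.Unary.Any using (Any)
open import Data.List.Relation.Unary.Linked as Linked using (Linked)
open import Data.Nat using (ℕ; zero; suc; _+_; _≤_; _<_; _≥_; _≟_)
open import Data.Product using (_×_; _,_; proj₁; proj₂; ∃-syntax; uncurry)
open import Data.Vec as Vec using (Vec)
open import Data.Vec.Properties as Vec using ()
open import Relation.Binary.PropositionalEquality using (_≡_)
open import Relation.Nullary.Decidable using (Dec; _×-dec_)

-- Zero parts are not stored, so distinct partitions have distinct lists of parts.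
record Partition : Set where
  constructor mkPartition
  field
    parts      : List ℕ
    decreasing : Linked _≥_ parts
    positive   : All (0 <_) parts

open Partition public

ℓ : Partition → ℕ
ℓ κ = length (parts κ)

nth : List ℕ → ℕ → ℕ
nth []       _       = 0
nth (p ∷ _)  zero    = p
nth (_ ∷ ps) (suc i) = nth ps i

-- The parts κ₁, κ₂, κ₃, padded with zeros.
_₁ _₂ _₃ : Partition → ℕ
κ ₁ = nth (parts κ) 0
κ ₂ = nth (parts κ) 1
κ ₃ = nth (parts κ) 2

-- A filling of a Young diagram (English notation), as its list of rows.
-- The entry i : Fin n stands for the variable x_{i+1}.
Filling : ℕ → Set
Filling n = List (List (Fin n))

words : ∀ n → ℕ → List (List (Fin n))
words n zero    = [] ∷ []
words n (suc k) = cartesianProductWith _∷_ (allFin n) (words n k)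

fillings : ∀ n → List ℕ → List (Filling n)
fillings n []       = [] ∷ []
fillings n (p ∷ ps) = cartesianProductWith _∷_ (words n p) (fillings n ps)

-- zip stops at the end of the shorter row, i.e. it pairs vertically adjacent boxes.
_Above_ : ∀ {n} → List (Fin n) → List (Fin n) → Set
r Above r′ = All (uncurry Fin._<_) (zip r r′)

SemiStandard : ∀ {n} → Filling n → Set
SemiStandard T = All (Linked Fin._≤_) T × Linked _Above_ T

semiStandard? : ∀ {n} (T : Filling n) → Dec (SemiStandard T)
semiStandard? T =
  All.all? (Linked.linked? Fin._≤?_) T
    ×-dec Linked.linked? (λ r r′ → All.all? (uncurry Fin._<?_) (zip r r′)) T

ssyt : ∀ n → Partition → List (Filling n)
ssyt n κ = filter semiStandard? (fillings n (parts κ))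

weight : ∀ {n} → Filling n → Vec ℕ n
weight T = Vec.tabulate (λ i → length (filter (i Fin.≟_) (concat T)))

-- Polynomials in n variables with coefficients in ℕ, as formal sums of monomials;
-- a monomial is its exponent vector, and a repeated monomial has that multiplicity
-- as its coefficient.
Poly : ℕ → Set
Poly n = List (Vec ℕ n)

coeff : ∀ {n} → Vec ℕ n → Poly n → ℕ
coeff α p = length (filter (Vec.≡-dec _≟_ α) p)

_⊗_ : ∀ {n} → Poly n → Poly n → Poly n
_⊗_ = cartesianProductWith (Vec.zipWith _+_)

-- s_κ(x₁,…,xₙ) = Σ x^T over semistandard tableaux T of shape κ with entries in {1,…,n}.
schur : ∀ n → Partition → Poly n
schur n κ = map weight (ssyt n κ)

sumℤ : List ℤ → ℤ
sumℤ = foldr ℤ._+_ (+ 0)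

-- Formal finite ℤ-linear combinations Σ a s_κ; terms with equal κ add up.
SchurComb : Set
SchurComb = List (ℤ × Partition)

coeffAt : Partition → SchurComb → ℤ
coeffAt κ L =
  sumℤ (map proj₁ (filter (λ t → List.≡-dec _≟_ (parts κ) (parts (proj₂ t))) L))

-- The coefficient of x^α in Σ a s_κ(x₁,…,xₙ).
evalCoeff : ∀ {n} → Vec ℕ n → SchurComb → ℤ
evalCoeff {n} α L = sumℤ (map (λ t → proj₁ t ℤ.* (+ coeff α (schur n (proj₂ t)))) L)

-- s_μ s_ν = Σ a s_κ as symmetric functions in x₁, x₂, …. A monomial involves only finitely
-- many variables, so this says that all coefficients agree in every number n of variables.
IsSchurExpansion : Partition → Partition → SchurComb → Set
IsSchurExpansion μ ν L =
  ∀ n (α : Vec ℕ n) → + coeff α (schur n μ ⊗ schur n ν) ≡ evalCoeff α L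

-- c is the coefficient of s_lam in s_μ s_ν.
IsLRCoefficient : (lam μ ν : Partition) → ℤ → Set
IsLRCoefficient lam μ ν c = ∃[ L ] (IsSchurExpansion μ ν L × coeffAt lam L ≡ c)

-- The pair (a , b) stands for the inequality a ≤ b.
hornInequalities : (lam μ ν : Partition) → List (ℕ × ℕ)
hornInequalities lam μ ν =
    (μ ₃ , μ ₂)
  ∷ (μ ₂ , μ ₁)
  ∷ (ν ₃ , ν ₂)
  ∷ (ν ₂ , ν ₁)
  ∷ (lam ₃ , lam ₂)
  ∷ (lam ₂ , lam ₁)
  ∷ (lam ₁ , μ ₁ + ν ₁)
  ∷ (lam ₂ , μ ₁ + ν ₂)
  ∷ (lam ₂ , μ ₂ + ν ₁)
  ∷ (lam ₃ , μ ₁ + ν ₃)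
  ∷ (lam ₃ , μ ₂ + ν ₂)
  ∷ (lam ₃ , μ ₃ + ν ₁)
  ∷ (μ ₃ + ν ₃ , lam ₃)
  ∷ (μ ₃ + ν ₂ , lam ₂)
  ∷ (μ ₂ + ν ₃ , lam ₂)
  ∷ (μ ₃ + ν ₁ , lam ₁)
  ∷ (μ ₂ + ν ₂ , lam ₁)
  ∷ (μ ₁ + ν ₃ , lam ₁)
  ∷ []

∣_∣₃ : Partition → ℕ
∣ κ ∣₃ = κ ₁ + κ ₂ + κ ₃

InHornCone : (lam μ ν : Partition) → Set
InHornCone lam μ ν =
  ∣ lam ∣₃ ≡ ∣ μ ∣₃ + ∣ ν ∣₃ × All (uncurry _≤_) (hornInequalities lam μ ν)

OnFacet : (lam μ ν : Partition) → Set
OnFacet lam μ ν = InHornCone lam μ ν × Any (uncurry _≡_) (hornInequalities lam μ ν)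

{-# OPTIONS --safe #-}
module Submission where

-- Let A be an alternating function on ℕ³ and β ∈ ℕ³ weakly decreasing. The sum of A (β + wt T) over
-- the semistandard tableaux T of a three-rowed shape ν does not change when T is restricted to the
-- tableaux whose entries, added to β row by row and each row from right to left, keep β strictly
-- decreasing: three sign-reversing involutions, which exchange ones with twos or twos with threes,
-- cancel the other tableaux. For β = ρ = (2,1,0) a single tableau is left, which is the bialternant
-- formula. Applied to the alternating function that detects λ + ρ, it turns the sum over s_μ s_ν
-- into the same kind of sum over s_ν for β = μ + ρ, so c is the number of restricted tableaux T of
-- shape ν with μ + wt T = λ.
-- These tableaux depend on a single integer, which runs over an interval with three lower and
-- six upper bounds. The 18 differences between an upper and a lower bound are the slacks of the
-- 18 Horn inequalities, so c = 1 if and only if no slack is negative and one of them vanishes.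

open import Defs
open import Data.Fin as Fin using (Fin; toℕ)
open import Data.Fin.Patterns using (0F; 1F; 2F; 3F; 4F; 5F)
import Data.Fin.Properties as Finₚ
open import Data.Integer as ℤ using (ℤ; +_; +≤+; 0ℤ; 1ℤ)
import Data.Integer.Properties as ℤₚ
import Data.Integer.Tactic.RingSolver as ℤ-Ring
open import Data.List using
  ( List; []; _∷_; _∷ʳ_; _++_; allFin; cartesianProduct; cartesianProductWith; concat;
    concatMap; deduplicate; filter; initLast; _∷ʳ′_; length; map; replicate; takeWhile; upTo)
import Data.List.Properties as Listₚ
import Data.List.Membership.DecPropositional as DecMembership
open import Data.List.Membership.Propositional using (_∈_; lose)
open import Data.List.Membership.Propositional.Properties using
  ( ∈-++⁺ˡ; ∈-++⁺ʳ; ∈-allFin; ∈-cartesianProduct⁺; ∈-cartesianProductWith⁺;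
    ∈-cartesianProductWith⁻; ∈-concatMap⁺; ∈-deduplicate⁺; ∈-filter⁺; ∈-filter⁻; ∈-map⁺;
    ∈-map⁻; ∈-upTo⁺)
open import Data.List.Membership.Propositional.Properties.WithK using (unique∧set⇒bag)
open import Data.List.Relation.Binary.BagAndSetEquality using (_∼[_]_; set; ∼bag⇒↭)
open import Data.List.Relation.Binary.Permutation.Propositional using (_↭_; ↭⇒↭ₛ)
import Data.List.Relation.Binary.Permutation.Propositional.Properties as ↭ₚ
import Data.List.Relation.Binary.Permutation.Setoid.Properties as ↭ₛₚ
open import Data.List.Relation.Binary.Pointwise as Pointwise using (Pointwise; []; _∷_)
open import Data.List.Relation.Unary.All as All using (All; []; _∷_)
import Data.List.Relation.Unary.All.Properties as Allₚ
open import Data.List.Relation.Unary.AllPairs using (AllPairs; []; _∷_)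
open import Data.List.Relation.Unary.Any as Any using (Any; here; there)
import Data.List.Relation.Unary.Any.Properties as Anyₚ
open import Data.List.Relation.Unary.Linked as Linked using (Linked; []; [-]; _∷_)
import Data.List.Relation.Unary.Linked.Properties as Linkedₚ
import Data.List.Relation.Unary.Unique.DecPropositional.Properties as DecUniqueₚ
open import Data.List.Relation.Unary.Unique.Propositional using (Unique)
import Data.List.Relation.Unary.Unique.Propositional.Properties as Uniqueₚ
open import Data.Nat using (ℕ; zero; suc; _+_; _∸_; _≤_; _<_; _≟_; _≤?_; _<?_; z≤n; s≤s; s≤s⁻¹)
open import Data.Nat.Properties
import Data.Nat.Tactic.RingSolver as ℕ-Ring
open import Data.Product using (_×_; _,_; ∃-syntax; ∃!; proj₁; proj₂; uncurry)
open import Data.Product.Function.NonDependent.Propositional using (_×-⇔_)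
import Data.Product.Properties as Productₚ
open import Data.Vec as Vec using (Vec; []; _∷_; lookup)
import Data.Vec.Properties as Vecₚ
open import Data.Vec.Relation.Binary.Pointwise.Inductive as VecPointwise using ([]; _∷_)
open import Function using (_∘_)
open import Function.Bundles using (_⇔_; mk⇔; Equivalence)
open import Function.Construct.Identity using (⇔-id)
import Function.Related.Propositional as Related
open import Relation.Binary.Definitions using (DecidableEquality)
open import Relation.Binary.PropositionalEquality
open import Relation.Nullary using (Dec; yes; no; ¬_; contradiction)
open import Relation.Nullary.Decidable using (_×-dec_; from-yes)
open import Relation.Unary using (Decidable)
open import Relation.Unary.Properties using (∁?)
open ≡-Reasoning

private variable
  A B C : Set
  P Q : A → Set
  x : A
  xs ys : List A
  f g : A → ℤ
  n p q r : ℕ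

-- Finite sums

∑ : List A → (A → ℤ) → ℤ
∑ xs f = sumℤ (map f xs)

infixr 5 ∑-syntax

∑-syntax : List A → (A → ℤ) → ℤ
∑-syntax = ∑

syntax ∑-syntax xs (λ x → e) = ∑[ x ∈ xs ] e

∑-cong : ∀ (xs : List A) → (∀ x → f x ≡ g x) → ∑ xs f ≡ ∑ xs g
∑-cong xs f≗g = cong sumℤ (Listₚ.map-cong f≗g xs)

∑-cong-∈ : ∀ (xs : List A) → (∀ {x} → x ∈ xs → f x ≡ g x) → ∑ xs f ≡ ∑ xs g
∑-cong-∈ xs f≗g = cong sumℤ (Listₚ.map-cong-local (All.tabulate f≗g))

∑-hom : ∀ (h : ℤ → ℤ) → h 0ℤ ≡ 0ℤ → (∀ m n → h (m ℤ.+ n) ≡ h m ℤ.+ h n) →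
        ∀ (xs : List A) (f : A → ℤ) → ∑[ x ∈ xs ] h (f x) ≡ h (∑ xs f)
∑-hom h h-0 h-+ []       f = sym h-0
∑-hom h h-0 h-+ (x ∷ xs) f =
  trans (cong (ℤ._+_ (h (f x))) (∑-hom h h-0 h-+ xs f)) (sym (h-+ (f x) (∑ xs f)))

∑-0 : ∀ (xs : List A) → ∑[ _ ∈ xs ] 0ℤ ≡ 0ℤ
∑-0 xs = ∑-hom (λ _ → 0ℤ) refl (λ _ _ → refl) xs (λ _ → 0ℤ)

∑-neg : ∀ (xs : List A) (f : A → ℤ) → ∑[ x ∈ xs ] (ℤ.- f x) ≡ ℤ.- ∑ xs f
∑-neg = ∑-hom ℤ.-_ refl ℤₚ.neg-distrib-+

∑-*ˡ : ∀ k (xs : List A) (f : A → ℤ) → ∑[ x ∈ xs ] (k ℤ.* f x) ≡ k ℤ.* ∑ xs f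
∑-*ˡ k = ∑-hom (k ℤ.*_) (ℤₚ.*-zeroʳ k) (ℤₚ.*-distribˡ-+ k)

∑-*ʳ : ∀ k (xs : List A) (f : A → ℤ) → ∑[ x ∈ xs ] (f x ℤ.* k) ≡ ∑ xs f ℤ.* k
∑-*ʳ k = ∑-hom (ℤ._* k) (ℤₚ.*-zeroˡ k) (ℤₚ.*-distribʳ-+ k)

∑-+ : ∀ (xs : List A) (f g : A → ℤ) → ∑[ x ∈ xs ] (f x ℤ.+ g x) ≡ ∑ xs f ℤ.+ ∑ xs g
∑-+ []       f g = refl
∑-+ (x ∷ xs) f g = trans (cong (ℤ._+_ (f x ℤ.+ g x)) (∑-+ xs f g)) (interchange (f x) (g x) _ _)
  where
  interchange : ∀ a b c d → (a ℤ.+ b) ℤ.+ (c ℤ.+ d) ≡ (a ℤ.+ c) ℤ.+ (b ℤ.+ d)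
  interchange = ℤ-Ring.solve-∀

∑-swap : ∀ (xs : List A) (ys : List B) (f : A → B → ℤ) →
         ∑[ x ∈ xs ] ∑[ y ∈ ys ] f x y ≡ ∑[ y ∈ ys ] ∑[ x ∈ xs ] f x y
∑-swap []       ys f = sym (∑-0 ys)
∑-swap (x ∷ xs) ys f = trans (cong (ℤ._+_ (∑ ys (f x))) (∑-swap xs ys f)) (sym (∑-+ ys (f x) _))

∑-map : ∀ (h : A → B) (xs : List A) (f : B → ℤ) → ∑ (map h xs) f ≡ ∑ xs (f ∘ h)
∑-map h xs f = cong sumℤ (sym (Listₚ.map-∘ xs))

∑-++ : ∀ (xs ys : List A) (f : A → ℤ) → ∑ (xs ++ ys) f ≡ ∑ xs f ℤ.+ ∑ ys f
∑-++ []       ys f = sym (ℤₚ.+-identityˡ _)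
∑-++ (x ∷ xs) ys f = trans (cong (ℤ._+_ (f x)) (∑-++ xs ys f)) (sym (ℤₚ.+-assoc (f x) _ _))

∑-cartesianProductWith : ∀ (_∙_ : A → B → C) xs ys (f : C → ℤ) →
  ∑ (cartesianProductWith _∙_ xs ys) f ≡ ∑[ x ∈ xs ] ∑[ y ∈ ys ] f (x ∙ y)
∑-cartesianProductWith _∙_ []       ys f = refl
∑-cartesianProductWith _∙_ (x ∷ xs) ys f =
  trans (∑-++ (map (x ∙_) ys) _ f)
        (cong₂ ℤ._+_ (∑-map (x ∙_) ys f) (∑-cartesianProductWith _∙_ xs ys f))

∑-↭ : ∀ (f : A → ℤ) → xs ↭ ys → ∑ xs f ≡ ∑ ys f
∑-↭ f xs↭ys =
  ↭ₛₚ.foldr-commMonoid (setoid ℤ) ℤₚ.+-0-isCommutativeMonoid (↭⇒↭ₛ (↭ₚ.map⁺ f xs↭ys))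

unique∧set⇒↭ : Unique xs → Unique ys → xs ∼[ set ] ys → xs ↭ ys
unique∧set⇒↭ xs! ys! xs∼ys = ∼bag⇒↭ (unique∧set⇒bag xs! ys! xs∼ys)

∑-filter-∁ : (P? : Decidable P) → ∀ xs (f : A → ℤ) →
             ∑ xs f ≡ ∑ (filter P? xs) f ℤ.+ ∑ (filter (∁? P?) xs) f
∑-filter-∁ P? []       f = refl
∑-filter-∁ P? (x ∷ xs) f with P? x
... | yes _ = trans (cong (ℤ._+_ (f x)) (∑-filter-∁ P? xs f)) (sym (ℤₚ.+-assoc (f x) _ _))
... | no  _ = trans (cong (ℤ._+_ (f x)) (∑-filter-∁ P? xs f)) (exchange (f x) (∑ (filter P? xs) f) _)
  where
  exchange : ∀ a b c → a ℤ.+ (b ℤ.+ c) ≡ b ℤ.+ (a ℤ.+ c)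
  exchange = ℤ-Ring.solve-∀

map-unique : ∀ {h : A → B} → (∀ {x y} → x ∈ xs → y ∈ xs → h x ≡ h y → x ≡ y) →
             Unique xs → Unique (map h xs)
map-unique h-injective []         = []
map-unique h-injective (x# ∷ xs!) =
  Allₚ.map⁺ (All.tabulate λ y∈xs hx≡hy →
    All.lookup x# y∈xs (h-injective (here refl) (there y∈xs) hx≡hy))
  ∷ map-unique (λ x∈xs y∈xs → h-injective (there x∈xs) (there y∈xs)) xs!

InvolutiveOn : List A → (A → A) → Set
InvolutiveOn xs σ = ∀ {x} → x ∈ xs → σ x ∈ xs × σ (σ x) ≡ x

∑-reindex : ∀ {σ : A → A} → Unique xs → InvolutiveOn xs σ → ∀ f → ∑ xs f ≡ ∑ xs (f ∘ σ)
∑-reindex {xs = xs} {σ} xs! involutive f = begin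
  ∑ xs f          ≡⟨ ∑-↭ f (unique∧set⇒↭ xs! (map-unique σ-injective xs!) (mk⇔ to from)) ⟩
  ∑ (map σ xs) f  ≡⟨ ∑-map σ xs f ⟩
  ∑ xs (f ∘ σ)    ∎
  where
  σ-injective : ∀ {x y} → x ∈ xs → y ∈ xs → σ x ≡ σ y → x ≡ y
  σ-injective x∈ y∈ σx≡σy =
    trans (sym (proj₂ (involutive x∈))) (trans (cong σ σx≡σy) (proj₂ (involutive y∈)))
  to : ∀ {y} → y ∈ xs → y ∈ map σ xs
  to y∈ = subst (_∈ map σ xs) (proj₂ (involutive y∈)) (∈-map⁺ σ (proj₁ (involutive y∈)))
  from : ∀ {y} → y ∈ map σ xs → y ∈ xs
  from y∈ with x , x∈ , refl ← ∈-map⁻ σ y∈ = proj₁ (involutive x∈)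

n≡-n⇒n≡0 : ∀ {n} → n ≡ ℤ.- n → n ≡ 0ℤ
n≡-n⇒n≡0 {+ zero} _ = refl

∑-sign-reversing : ∀ {σ : A → A} → Unique xs → InvolutiveOn xs σ →
                   (∀ {x} → x ∈ xs → f (σ x) ≡ ℤ.- f x) → ∑ xs f ≡ 0ℤ
∑-sign-reversing {xs = xs} {f} {σ} xs! involutive reversing = n≡-n⇒n≡0 (begin
  ∑ xs f                  ≡⟨ ∑-reindex xs! involutive f ⟩
  ∑ xs (f ∘ σ)            ≡⟨ ∑-cong-∈ xs reversing ⟩
  (∑[ x ∈ xs ] ℤ.- f x)   ≡⟨ ∑-neg xs f ⟩
  ℤ.- ∑ xs f              ∎)

∑-cancel : ∀ {σ : A → A} (P? : Decidable P) → Unique xs →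
           (∀ {x} → x ∈ xs → ¬ P x → (σ x ∈ xs × ¬ P (σ x)) × σ (σ x) ≡ x × f (σ x) ≡ ℤ.- f x) →
           ∑ xs f ≡ ∑ (filter P? xs) f
∑-cancel {P = P} {xs = xs} {f} {σ} P? xs! σ-reverses = begin
  ∑ xs f
    ≡⟨ ∑-filter-∁ P? xs f ⟩
  ∑ (filter P? xs) f ℤ.+ ∑ rejected f
    ≡⟨ cong (ℤ._+_ (∑ (filter P? xs) f))
         (∑-sign-reversing (Uniqueₚ.filter⁺ (∁? P?) xs!) involutive reversing) ⟩
  ∑ (filter P? xs) f ℤ.+ 0ℤ
    ≡⟨ ℤₚ.+-identityʳ _ ⟩
  ∑ (filter P? xs) f ∎
  where
  rejected : List _
  rejected = filter (∁? P?) xs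
  involutive : InvolutiveOn rejected σ
  involutive x∈
    with x∈xs , ¬px ← ∈-filter⁻ (∁? P?) {xs = xs} x∈
    with (σx∈xs , ¬pσx) , σσx≡x , _ ← σ-reverses x∈xs ¬px = ∈-filter⁺ (∁? P?) σx∈xs ¬pσx , σσx≡x
  reversing : ∀ {x} → x ∈ rejected → f (σ x) ≡ ℤ.- f x
  reversing x∈ with x∈xs , ¬px ← ∈-filter⁻ (∁? P?) {xs = xs} x∈ = proj₂ (proj₂ (σ-reverses x∈xs ¬px))

∃!-cong : (∀ {x} → P x → Q x) → (∀ {x} → Q x → P x) → ∃! _≡_ P → ∃! _≡_ Q
∃!-cong P⇒Q Q⇒P (x , px , x≡) = x , P⇒Q px , λ qy → x≡ (Q⇒P qy)

∃!-∈⇒↭ : Unique xs → ((x , _) : ∃! _≡_ (_∈ xs)) → xs ↭ x ∷ []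
∃!-∈⇒↭ {xs = xs} xs! (x , x∈xs , x≡) = unique∧set⇒↭ xs! ([] ∷ []) (mk⇔ (λ y∈ → here (sym (x≡ y∈))) from)
  where
  from : ∀ {y} → y ∈ x ∷ [] → y ∈ xs
  from (here refl) = x∈xs

∑-1 : (xs : List A) → ∑[ _ ∈ xs ] 1ℤ ≡ + length xs
∑-1 []       = refl
∑-1 (_ ∷ xs) = cong (ℤ._+_ 1ℤ) (∑-1 xs)

∑-1≡1⇔∃! : Unique xs → (∑[ _ ∈ xs ] 1ℤ ≡ 1ℤ) ⇔ ∃! _≡_ (_∈ xs)
∑-1≡1⇔∃! {xs = xs} xs! = mk⇔
  (λ ∑≡1 → to xs (ℤₚ.+-injective (trans (sym (∑-1 xs)) ∑≡1)))
  (λ ∃!x → ∑-↭ (λ _ → 1ℤ) (∃!-∈⇒↭ xs! ∃!x))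
  where
  to : ∀ xs → length xs ≡ 1 → ∃! _≡_ (_∈ xs)
  to (x ∷ []) _ = x , here refl , λ { (here y≡x) → sym y≡x }

𝟙 : Dec B → ℤ
𝟙 (yes _) = 1ℤ
𝟙 (no  _) = 0ℤ

𝟙-yes : (b? : Dec B) → B → 𝟙 b? ≡ 1ℤ
𝟙-yes (yes _) b = refl
𝟙-yes (no ¬b) b = contradiction b ¬b

𝟙-no : (b? : Dec B) → ¬ B → 𝟙 b? ≡ 0ℤ
𝟙-no (yes b) ¬b = contradiction b ¬b
𝟙-no (no _)  ¬b = refl

𝟙-cong : (b? : Dec B) (c? : Dec C) → (B → C) → (C → B) → 𝟙 b? ≡ 𝟙 c?
𝟙-cong (yes b) c? to from = sym (𝟙-yes c? (to b))
𝟙-cong (no ¬b) c? to from = sym (𝟙-no c? (¬b ∘ from))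

∑-𝟙-* : (P? : Decidable P) → ∀ xs (f : A → ℤ) → ∑[ x ∈ xs ] (𝟙 (P? x) ℤ.* f x) ≡ ∑ (filter P? xs) f
∑-𝟙-* P? []       f = refl
∑-𝟙-* P? (x ∷ xs) f with P? x
... | yes _ = cong₂ ℤ._+_ (ℤₚ.*-identityˡ (f x)) (∑-𝟙-* P? xs f)
... | no  _ = trans (cong₂ ℤ._+_ (ℤₚ.*-zeroˡ (f x)) (∑-𝟙-* P? xs f)) (ℤₚ.+-identityˡ _)

∑-𝟙 : (P? : Decidable P) → ∀ xs → ∑[ x ∈ xs ] 𝟙 (P? x) ≡ ∑[ _ ∈ filter P? xs ] 1ℤ
∑-𝟙 P? xs = begin
  (∑[ x ∈ xs ] 𝟙 (P? x))             ≡⟨ ∑-cong xs (λ x → ℤₚ.*-identityʳ (𝟙 (P? x))) ⟨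
  (∑[ x ∈ xs ] (𝟙 (P? x) ℤ.* 1ℤ))    ≡⟨ ∑-𝟙-* P? xs (λ _ → 1ℤ) ⟩
  (∑[ _ ∈ filter P? xs ] 1ℤ)         ∎

-- Patterns

infixl 6 _⊕_

_⊕_ : Vec ℕ n → Vec ℕ n → Vec ℕ n
_⊕_ = Vec.zipWith _+_

pattern ⟨_,_,_⟩ x y z = x Vec.∷ y Vec.∷ z Vec.∷ Vec.[]

⟨⟩-cong : ∀ {x x′ y y′ z z′ : ℕ} → x ≡ x′ → y ≡ y′ → z ≡ z′ → ⟨ x , y , z ⟩ ≡ ⟨ x′ , y′ , z′ ⟩
⟨⟩-cong refl refl refl = refl

swap₁₂ swap₂₃ : Vec ℕ 3 → Vec ℕ 3
swap₁₂ ⟨ x , y , z ⟩ = ⟨ y , x , z ⟩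
swap₂₃ ⟨ x , y , z ⟩ = ⟨ x , z , y ⟩

record Alternating (A : Vec ℕ 3 → ℤ) : Set where
  field
    alternating₁₂ : ∀ v → A (swap₁₂ v) ≡ ℤ.- A v
    alternating₂₃ : ∀ v → A (swap₂₃ v) ≡ ℤ.- A v

open Alternating

-- (a , b , c , d , e) stands for the tableau with a ones, b twos and c threes in the first row,
-- d twos and e threes in the second row, and only threes in the third row.
Pattern : Set
Pattern = ℕ × ℕ × ℕ × ℕ × ℕ

content : (r : ℕ) → Pattern → Vec ℕ 3
content r (a , b , c , d , e) = ⟨ a , b + d , c + (e + r) ⟩

-- The column condition d ≤ a appears as q ≤ a + e: in this form q ∸ a is a lower bound
-- for both b and e.
IsPattern : (p q r : ℕ) → Pattern → Set
IsPattern p q r (a , b , c , d , e) = a + b + c ≡ p × d + e ≡ q × q ≤ a + b × q ≤ a + e × r ≤ d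

isPattern? : ∀ p q r → Decidable (IsPattern p q r)
isPattern? p q r (a , b , c , d , e) =
  a + b + c ≟ p ×-dec d + e ≟ q ×-dec q ≤? a + b ×-dec q ≤? a + e ×-dec r ≤? d

isPattern⇒d≤a : ∀ (t@(a , _ , _ , d , _) : Pattern) → IsPattern p q r t → d ≤ a
isPattern⇒d≤a (a , _ , _ , d , e) (_ , refl , _ , q≤a+e , _) = +-cancelʳ-≤ e d a q≤a+e

opaque

  box : (p q : ℕ) → List Pattern
  box p q = up p (up p (up p (up q (upTo (suc q)))))
    where
    up : ℕ → List A → List (ℕ × A)
    up n = cartesianProduct (upTo (suc n))

  patterns : (p q r : ℕ) → List Pattern
  patterns p q r = filter (isPattern? p q r) (box p q)

  patterns-unique : ∀ p q r → Unique (patterns p q r)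
  patterns-unique p q r =
    Uniqueₚ.filter⁺ (isPattern? p q r) (up p (up p (up p (up q (Uniqueₚ.upTo⁺ (suc q))))))
    where
    up : ∀ n → Unique xs → Unique (cartesianProduct (upTo (suc n)) xs)
    up n = Uniqueₚ.cartesianProduct⁺ (Uniqueₚ.upTo⁺ (suc n))

  ∈-patterns⁺ : ∀ {t} → IsPattern p q r t → t ∈ patterns p q r
  ∈-patterns⁺ {p} {q} {r} {a , b , c , d , e} t-pattern@(refl , refl , _) =
    ∈-filter⁺ (isPattern? p q r)
      (up (m≤n⇒m≤n+o c (m≤m+n a b)) (up (m≤n⇒m≤n+o c (m≤n+m b a)) (up (m≤n+m c (a + b))
        (up (m≤m+n d e) (∈-upTo⁺ (s≤s (m≤n+m e d)))))))
      t-pattern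
    where
    up : ∀ {m n} {y : B} {ys} → m ≤ n → y ∈ ys → (m , y) ∈ cartesianProduct (upTo (suc n)) ys
    up m≤n = ∈-cartesianProduct⁺ (∈-upTo⁺ (s≤s m≤n))

  ∈-patterns⁻ : ∀ {t} → t ∈ patterns p q r → IsPattern p q r t
  ∈-patterns⁻ {p} {q} {r} t∈ = proj₂ (∈-filter⁻ (isPattern? p q r) {xs = box p q} t∈)

-- Reflections of patterns

m≤n+[m∸n+o] : ∀ m n o → m ≤ n + (m ∸ n + o)
m≤n+[m∸n+o] m n o = ≤-trans (m≤n+m∸n m n) (+-monoʳ-≤ n (m≤m+n (m ∸ n) o))

k+[l+[m∸k]∸l]≡m : ∀ {k m} l → k ≤ m → k + (l + (m ∸ k) ∸ l) ≡ m
k+[l+[m∸k]∸l]≡m {k} {m} l k≤m = trans (cong (_+_ k) (m+n∸m≡n l (m ∸ k))) (m+[n∸m]≡n k≤m)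

k+[n∸l]+[l+[m∸k]]≡m+n : ∀ {k l m n} → k ≤ m → l ≤ n → k + (n ∸ l) + (l + (m ∸ k)) ≡ m + n
k+[n∸l]+[l+[m∸k]]≡m+n {k} {l} k≤m l≤n
  with i , refl ← m≤n⇒∃[o]m+o≡n k≤m
     | j , refl ← m≤n⇒∃[o]m+o≡n l≤n
  rewrite m+n∸m≡n k i | m+n∸m≡n l j = exchange k l i j
  where
  exchange : ∀ k l i j → k + j + (l + i) ≡ k + i + (l + j)
  exchange = ℕ-Ring.solve-∀

-- Each reflection replaces one or two pairs of entries k + i , l + j by k + j , l + i, where k and l
-- are lower bounds for the two entries.
reflect₁₂ : (k : ℕ) → Pattern → Pattern
reflect₁₂ k (a , b , c , d , e) = d + (b ∸ k) , k + (a ∸ d) , c , d , e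

reflect₂₃ : (q r k : ℕ) → Pattern → Pattern
reflect₂₃ q r k (a , b , c , d , e) =
  a , (q ∸ a) + (c ∸ k) , k + (b ∸ (q ∸ a)) , r + (e ∸ (q ∸ a)) , (q ∸ a) + (d ∸ r)

reflectRow₂ : (r k : ℕ) → Pattern → Pattern
reflectRow₂ r k (a , b , c , d , e) = a , b , c , r + (e ∸ k) , k + (d ∸ r)

reflect₁₂-isPattern : ∀ k {t@(_ , b , _) : Pattern} → IsPattern p q r t → k ≤ b →
                      IsPattern p q r (reflect₁₂ k t)
reflect₁₂-isPattern {q = q} k {t@(a , b , c , d , e)} t-pattern@(row₁ , row₂ , q≤a+b , _ , r≤d) k≤b =
    trans (cong (_+ c) a+b) row₁
  , row₂
  , subst (q ≤_) (sym a+b) q≤a+b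
  , subst (_≤ d + (b ∸ k) + e) row₂ (+-monoˡ-≤ e (m≤m+n d (b ∸ k)))
  , r≤d
  where
  a+b : d + (b ∸ k) + (k + (a ∸ d)) ≡ a + b
  a+b = k+[n∸l]+[l+[m∸k]]≡m+n (isPattern⇒d≤a t t-pattern) k≤b

reflect₁₂-involutive : ∀ k {t@(_ , b , _) : Pattern} → IsPattern p q r t → k ≤ b →
                       reflect₁₂ k (reflect₁₂ k t) ≡ t
reflect₁₂-involutive k {t@(a , b , c , d , e)} t-pattern k≤b =
  cong₂ (λ a b → a , b , c , d , e)
    (k+[l+[m∸k]∸l]≡m k (isPattern⇒d≤a t t-pattern)) (k+[l+[m∸k]∸l]≡m d k≤b)

content-reflect₁₂ : ∀ k (t@(_ , b , _) : Pattern) {x y} → IsPattern p q r t → k ≤ b → x ≡ k + y →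
  ∀ z → ⟨ x , y , z ⟩ ⊕ content r (reflect₁₂ k t) ≡ swap₁₂ (⟨ x , y , z ⟩ ⊕ content r t)
content-reflect₁₂ k t@(a , _ , _ , d , _) {y = y} t-pattern k≤b refl z
  with i , refl ← m≤n⇒∃[o]m+o≡n (isPattern⇒d≤a t t-pattern)
     | j , refl ← m≤n⇒∃[o]m+o≡n k≤b
  rewrite m+n∸m≡n d i | m+n∸m≡n k j =
  ⟨⟩-cong (first k y d j) (second k y d i) refl
  where
  first : ∀ k y d j → k + y + (d + j) ≡ y + (k + j + d)
  first = ℕ-Ring.solve-∀
  second : ∀ k y d i → y + (k + i + d) ≡ k + y + (d + i)
  second = ℕ-Ring.solve-∀

isPattern⇒q∸a≤b : ∀ (t@(a , b , _) : Pattern) → IsPattern p q r t → q ∸ a ≤ b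
isPattern⇒q∸a≤b {q = q} (a , _) (_ , _ , q≤a+b , _) = m≤n+o⇒m∸n≤o q a q≤a+b

isPattern⇒q∸a≤e : ∀ (t@(a , _ , _ , _ , e) : Pattern) → IsPattern p q r t → q ∸ a ≤ e
isPattern⇒q∸a≤e {q = q} (a , _) (_ , _ , _ , q≤a+e , _) = m≤n+o⇒m∸n≤o q a q≤a+e

reflect₂₃-isPattern : ∀ k {t@(_ , _ , c , _) : Pattern} → IsPattern p q r t → k ≤ c →
                      IsPattern p q r (reflect₂₃ q r k t)
reflect₂₃-isPattern {p} {q} {r} k {t@(a , b , c , d , e)} t-pattern@(row₁ , row₂ , _ , _ , r≤d) k≤c =
    (begin
      a + ((q ∸ a) + (c ∸ k)) + (k + (b ∸ (q ∸ a)))    ≡⟨ +-assoc a _ _ ⟩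
      a + ((q ∸ a) + (c ∸ k) + (k + (b ∸ (q ∸ a))))
        ≡⟨ cong (_+_ a) (k+[n∸l]+[l+[m∸k]]≡m+n (isPattern⇒q∸a≤b t t-pattern) k≤c) ⟩
      a + (b + c)                                      ≡⟨ +-assoc a b c ⟨
      a + b + c                                        ≡⟨ row₁ ⟩
      p                                                ∎)
  , trans (k+[n∸l]+[l+[m∸k]]≡m+n r≤d (isPattern⇒q∸a≤e t t-pattern)) row₂
  , m≤n+[m∸n+o] q a (c ∸ k)
  , m≤n+[m∸n+o] q a (d ∸ r)
  , m≤m+n r (e ∸ (q ∸ a))

reflect₂₃-involutive : ∀ k {t@(_ , _ , c , _) : Pattern} → IsPattern p q r t → k ≤ c →
                       reflect₂₃ q r k (reflect₂₃ q r k t) ≡ t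
reflect₂₃-involutive {q = q} {r} k {t@(a , b , c , d , e)} t-pattern@(_ , _ , _ , _ , r≤d) k≤c =
  cong₂ (λ (b , c) (d , e) → a , b , c , d , e)
    (cong₂ _,_ (k+[l+[m∸k]∸l]≡m k (isPattern⇒q∸a≤b t t-pattern)) (k+[l+[m∸k]∸l]≡m (q ∸ a) k≤c))
    (cong₂ _,_ (k+[l+[m∸k]∸l]≡m (q ∸ a) r≤d) (k+[l+[m∸k]∸l]≡m r (isPattern⇒q∸a≤e t t-pattern)))

content-reflect₂₃ : ∀ k (t@(_ , _ , c , _) : Pattern) {y z} → IsPattern p q r t → k ≤ c → y ≡ k + z →
  ∀ x → ⟨ x , y , z ⟩ ⊕ content r (reflect₂₃ q r k t) ≡ swap₂₃ (⟨ x , y , z ⟩ ⊕ content r t)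
content-reflect₂₃ {q = q} {r} k t@(a , _) {z = z} t-pattern@(_ , _ , _ , _ , r≤d) k≤c refl x
  with δ≤b ← isPattern⇒q∸a≤b t t-pattern | δ≤e ← isPattern⇒q∸a≤e t t-pattern
  with δ ← q ∸ a
  with i , refl ← m≤n⇒∃[o]m+o≡n δ≤b
     | j , refl ← m≤n⇒∃[o]m+o≡n k≤c
     | l , refl ← m≤n⇒∃[o]m+o≡n r≤d
     | m , refl ← m≤n⇒∃[o]m+o≡n δ≤e
  rewrite m+n∸m≡n δ i | m+n∸m≡n k j | m+n∸m≡n r l | m+n∸m≡n δ m =
  ⟨⟩-cong refl (second k z δ j r m) (third k z δ i r l)
  where
  second : ∀ k z δ j r m → k + z + (δ + j + (r + m)) ≡ z + (k + j + (δ + m + r))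
  second = ℕ-Ring.solve-∀
  third : ∀ k z δ i r l → z + (k + i + (δ + l + r)) ≡ k + z + (δ + i + (r + l))
  third = ℕ-Ring.solve-∀

reflectRow₂-isPattern : ∀ k {t@(_ , b , _ , _ , e) : Pattern} → IsPattern p q r t → b ≤ k → k ≤ e →
                        IsPattern p q r (reflectRow₂ r k t)
reflectRow₂-isPattern {r = r} k {a , b , c , d , e} (row₁ , row₂ , q≤a+b , _ , r≤d) b≤k k≤e =
    row₁
  , trans (k+[n∸l]+[l+[m∸k]]≡m+n r≤d k≤e) row₂
  , q≤a+b
  , ≤-trans q≤a+b (+-monoʳ-≤ a (m≤n⇒m≤n+o (d ∸ r) b≤k))
  , m≤m+n r (e ∸ k)

reflectRow₂-involutive : ∀ k {t@(_ , _ , _ , _ , e) : Pattern} → IsPattern p q r t → k ≤ e →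
                         reflectRow₂ r k (reflectRow₂ r k t) ≡ t
reflectRow₂-involutive {r = r} k {a , b , c , d , e} (_ , _ , _ , _ , r≤d) k≤e =
  cong₂ (λ d e → a , b , c , d , e) (k+[l+[m∸k]∸l]≡m k r≤d) (k+[l+[m∸k]∸l]≡m r k≤e)

content-reflectRow₂ : ∀ k (t@(_ , b , c , _ , e) : Pattern) {y z} →
  IsPattern p q r t → k ≤ e → z + c + k ≡ y + b →
  ∀ x → ⟨ x , y , z ⟩ ⊕ content r (reflectRow₂ r k t) ≡ swap₂₃ (⟨ x , y , z ⟩ ⊕ content r t)
content-reflectRow₂ {r = r} k (_ , b , c , _) {y} {z} (_ , _ , _ , _ , r≤d) k≤e z+c+k≡y+b x
  with i , refl ← m≤n⇒∃[o]m+o≡n r≤d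
     | j , refl ← m≤n⇒∃[o]m+o≡n k≤e
  rewrite m+n∸m≡n r i | m+n∸m≡n k j = ⟨⟩-cong refl (second≡third j) (sym (second≡third i))
  where
  second≡third : ∀ n → y + (b + (r + n)) ≡ z + (c + (k + n + r))
  second≡third n = begin
    y + (b + (r + n))      ≡⟨ +-assoc y b (r + n) ⟨
    y + b + (r + n)        ≡⟨ cong (_+ (r + n)) z+c+k≡y+b ⟨
    z + c + k + (r + n)    ≡⟨ regroup z c k r n ⟩
    z + (c + (k + n + r))  ∎
    where
    regroup : ∀ z c k r n → z + c + k + (r + n) ≡ z + (c + (k + n + r))
    regroup = ℕ-Ring.solve-∀

∑-patterns-symmetric : ∀ (swap : Vec ℕ 3 → Vec ℕ 3) (reflection : Pattern → Pattern) →
  (∀ {t} → IsPattern p q r t → IsPattern p q r (reflection t) × reflection (reflection t) ≡ t) →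
  (∀ {t} → IsPattern p q r t → content r (reflection t) ≡ swap (content r t)) →
  ∀ f → ∑ (patterns p q r) (f ∘ swap ∘ content r) ≡ ∑ (patterns p q r) (f ∘ content r)
∑-patterns-symmetric {p} {q} {r} swap reflection involutive swaps f = sym (begin
  ∑ (patterns p q r) (f ∘ content r)
    ≡⟨ ∑-reindex (patterns-unique p q r) involutiveOn (f ∘ content r) ⟩
  ∑ (patterns p q r) (f ∘ content r ∘ reflection)
    ≡⟨ ∑-cong-∈ (patterns p q r) (λ t∈ → cong f (swaps (∈-patterns⁻ t∈))) ⟩
  ∑ (patterns p q r) (f ∘ swap ∘ content r) ∎)
  where
  involutiveOn : InvolutiveOn (patterns p q r) reflection
  involutiveOn t∈ with t′-pattern , reflected ← involutive (∈-patterns⁻ t∈) =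
    ∈-patterns⁺ t′-pattern , reflected

∑-patterns-swap₁₂ : ∀ p q r f →
  ∑ (patterns p q r) (f ∘ swap₁₂ ∘ content r) ≡ ∑ (patterns p q r) (f ∘ content r)
∑-patterns-swap₁₂ p q r = ∑-patterns-symmetric swap₁₂ (reflect₁₂ 0)
  (λ t-pattern → reflect₁₂-isPattern 0 t-pattern z≤n , reflect₁₂-involutive 0 t-pattern z≤n)
  (λ {t} t-pattern → content-reflect₁₂ 0 t {y = 0} t-pattern z≤n refl 0)

∑-patterns-swap₂₃ : ∀ p q r f →
  ∑ (patterns p q r) (f ∘ swap₂₃ ∘ content r) ≡ ∑ (patterns p q r) (f ∘ content r)
∑-patterns-swap₂₃ p q r = ∑-patterns-symmetric swap₂₃ (reflect₂₃ q r 0)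
  (λ t-pattern → reflect₂₃-isPattern 0 t-pattern z≤n , reflect₂₃-involutive 0 t-pattern z≤n)
  (λ {t} t-pattern → content-reflect₂₃ 0 t {z = 0} t-pattern z≤n refl 0)

-- The Littlewood–Richardson rule

-- Adding the entries of a tableau to ⟨ x , y , z ⟩ row by row, each row from right to left, keeps
-- the coordinates strictly decreasing if and only if the following three conditions hold.
threes₁-fit? : ∀ y z → Decidable (λ ((a , b , c , d , e) : Pattern) → z + c < y)
threes₁-fit? y z (a , b , c , d , e) = z + c <? y

twos₁-fit? : ∀ x y → Decidable (λ ((a , b , c , d , e) : Pattern) → y + b < x)
twos₁-fit? x y (a , b , c , d , e) = y + b <? x

threes₂-fit? : ∀ y z → Decidable (λ ((a , b , c , d , e) : Pattern) → z + (c + e) < y + b)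
threes₂-fit? y z (a , b , c , d , e) = z + (c + e) <? y + b

IsDominantPattern : (x y z p q r : ℕ) → Pattern → Set
IsDominantPattern x y z p q r t@(a , b , c , d , e) =
  IsPattern p q r t × z + c < y × y + b < x × z + (c + e) < y + b

opaque

  dominantPatterns : (x y z p q r : ℕ) → List Pattern
  dominantPatterns x y z p q r =
    filter (threes₂-fit? y z) (filter (twos₁-fit? x y) (filter (threes₁-fit? y z) (patterns p q r)))

  dominantPatterns-unique : ∀ x y z p q r → Unique (dominantPatterns x y z p q r)
  dominantPatterns-unique x y z p q r =
    Uniqueₚ.filter⁺ (threes₂-fit? y z) (Uniqueₚ.filter⁺ (twos₁-fit? x y)
      (Uniqueₚ.filter⁺ (threes₁-fit? y z) (patterns-unique p q r)))

  ∈-dominantPatterns⁺ : ∀ {x y z t} → IsDominantPattern x y z p q r t → t ∈ dominantPatterns x y z p q r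
  ∈-dominantPatterns⁺ {x = x} {y} {z} (t-pattern , c-fits , b-fits , e-fits) =
    ∈-filter⁺ (threes₂-fit? y z) (∈-filter⁺ (twos₁-fit? x y) (∈-filter⁺ (threes₁-fit? y z)
      (∈-patterns⁺ t-pattern) c-fits) b-fits) e-fits

  ∈-dominantPatterns⁻ : ∀ {x y z t} → t ∈ dominantPatterns x y z p q r → IsDominantPattern x y z p q r t
  ∈-dominantPatterns⁻ {p} {q} {r} {x = x} {y} {z} t∈
    with t∈₂ , e-fits ← ∈-filter⁻ (threes₂-fit? y z)
                          {xs = filter (twos₁-fit? x y) (filter (threes₁-fit? y z) (patterns p q r))} t∈
    with t∈₁ , b-fits ← ∈-filter⁻ (twos₁-fit? x y) {xs = filter (threes₁-fit? y z) (patterns p q r)} t∈₂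
    with t∈₀ , c-fits ← ∈-filter⁻ (threes₁-fit? y z) {xs = patterns p q r} t∈₁ =
    ∈-patterns⁻ t∈₀ , c-fits , b-fits , e-fits

module _ {A : Vec ℕ 3 → ℤ} (A-alternating : Alternating A)
         {x y z : ℕ} (y≤x : y ≤ x) (z≤y : z ≤ y) (p q r : ℕ) where

  private
    summand : Pattern → ℤ
    summand t = A (⟨ x , y , z ⟩ ⊕ content r t)

    fit₁ fit₂ : List Pattern
    fit₁ = filter (threes₁-fit? y z) (patterns p q r)
    fit₂ = filter (twos₁-fit? x y) fit₁

    fit₁-unique : Unique fit₁
    fit₁-unique = Uniqueₚ.filter⁺ (threes₁-fit? y z) (patterns-unique p q r)

    fit₂-unique : Unique fit₂
    fit₂-unique = Uniqueₚ.filter⁺ (twos₁-fit? x y) fit₁-unique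

    ∈-fit₁⁻ : ∀ {t@(_ , _ , c , _) : Pattern} → t ∈ fit₁ → IsPattern p q r t × z + c < y
    ∈-fit₁⁻ t∈ with t∈patterns , c-fits ← ∈-filter⁻ (threes₁-fit? y z) {xs = patterns p q r} t∈ =
      ∈-patterns⁻ t∈patterns , c-fits

    cancel-threes₁ : ∑ (patterns p q r) summand ≡ ∑ fit₁ summand
    cancel-threes₁ = ∑-cancel {σ = reflect₂₃ q r k} (threes₁-fit? y z) (patterns-unique p q r)
      λ {t@(a , b , c , d , e)} t∈ ¬c-fits →
        let t-pattern = ∈-patterns⁻ t∈
            k≤c = m≤n+o⇒m∸n≤o y z (≮⇒≥ ¬c-fits)
        in ( ∈-patterns⁺ (reflect₂₃-isPattern k t-pattern k≤c)
           , ≤⇒≯ (m≤n+[m∸n+o] y z (b ∸ (q ∸ a))))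
         , reflect₂₃-involutive k t-pattern k≤c
         , trans (cong A (content-reflect₂₃ k t t-pattern k≤c (sym (m∸n+n≡m z≤y)) x))
                 (alternating₂₃ A-alternating _)
      where
      k : ℕ
      k = y ∸ z

    cancel-twos₁ : ∑ fit₁ summand ≡ ∑ fit₂ summand
    cancel-twos₁ = ∑-cancel {σ = reflect₁₂ k} (twos₁-fit? x y) fit₁-unique
      λ {t@(a , b , c , d , e)} t∈ ¬b-fits →
        let t-pattern , c-fits = ∈-fit₁⁻ t∈
            k≤b = m≤n+o⇒m∸n≤o x y (≮⇒≥ ¬b-fits)
        in ( ∈-filter⁺ (threes₁-fit? y z) (∈-patterns⁺ (reflect₁₂-isPattern k t-pattern k≤b)) c-fits
           , ≤⇒≯ (m≤n+[m∸n+o] x y (a ∸ d)))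
         , reflect₁₂-involutive k t-pattern k≤b
         , trans (cong A (content-reflect₁₂ k t t-pattern k≤b (sym (m∸n+n≡m y≤x)) z))
                 (alternating₁₂ A-alternating _)
      where
      k : ℕ
      k = x ∸ y

    opaque
      unfolding dominantPatterns

      cancel-threes₂ : ∑ fit₂ summand ≡ ∑ (dominantPatterns x y z p q r) summand
      cancel-threes₂ = ∑-cancel {σ = λ t@(_ , b , c , _) → reflectRow₂ r (y + b ∸ (z + c)) t}
        (threes₂-fit? y z) fit₂-unique
        λ {t@(a , b , c , d , e)} t∈ ¬e-fits →
          let t∈fit₁ , b-fits = ∈-filter⁻ (twos₁-fit? x y) {xs = fit₁} t∈
              t-pattern , c-fits = ∈-fit₁⁻ t∈fit₁
              k = y + b ∸ (z + c)
              k≤e = m≤n+o⇒m∸n≤o (y + b) (z + c) (subst (y + b ≤_) (sym (+-assoc z c e)) (≮⇒≥ ¬e-fits))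
              z+c≤y+b = m≤n⇒m≤n+o b (<⇒≤ c-fits)
              b≤k = m+n≤o⇒m≤o∸n b (subst (_≤ y + b) (+-comm (z + c) b) (+-monoˡ-≤ b (<⇒≤ c-fits)))
              y+b≤z+[c+e′] = subst (y + b ≤_) (+-assoc z c _) (m≤n+[m∸n+o] (y + b) (z + c) (d ∸ r))
          in ( ∈-filter⁺ (twos₁-fit? x y) (∈-filter⁺ (threes₁-fit? y z)
                 (∈-patterns⁺ (reflectRow₂-isPattern k t-pattern b≤k k≤e)) c-fits) b-fits
             , ≤⇒≯ y+b≤z+[c+e′])
           , reflectRow₂-involutive k t-pattern k≤e
           , trans (cong A (content-reflectRow₂ k t t-pattern k≤e (m+[n∸m]≡n z+c≤y+b) x))
                   (alternating₂₃ A-alternating _)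

  lr-rule : ∑[ t ∈ patterns p q r ] A (⟨ x , y , z ⟩ ⊕ content r t) ≡
            ∑[ t ∈ dominantPatterns x y z p q r ] A (⟨ x , y , z ⟩ ⊕ content r t)
  lr-rule = begin
    ∑ (patterns p q r) summand                ≡⟨ cancel-threes₁ ⟩
    ∑ fit₁ summand                            ≡⟨ cancel-twos₁ ⟩
    ∑ fit₂ summand                            ≡⟨ cancel-threes₂ ⟩
    ∑ (dominantPatterns x y z p q r) summand  ∎

ρ : Vec ℕ 3
ρ = ⟨ 2 , 1 , 0 ⟩

bialternant : ∀ {A} → Alternating A → q ≤ p → r ≤ q →
  ∑[ t ∈ patterns p q r ] A (ρ ⊕ content r t) ≡ A (ρ ⊕ ⟨ p , q , r ⟩)
bialternant {q} {p} {r} {A} A-alternating q≤p r≤q = begin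
  (∑[ t ∈ patterns p q r ] summand t)
    ≡⟨ lr-rule A-alternating (s≤s z≤n) z≤n p q r ⟩
  (∑[ t ∈ dominantPatterns 2 1 0 p q r ] summand t)
    ≡⟨ ∑-↭ summand (∃!-∈⇒↭ (dominantPatterns-unique 2 1 0 p q r)
         ( highest , ∈-dominantPatterns⁺ highest-dominant
         , λ t∈ → highest≡ _ (∈-dominantPatterns⁻ t∈))) ⟩
  summand highest ℤ.+ 0ℤ
    ≡⟨ ℤₚ.+-identityʳ _ ⟩
  A (ρ ⊕ ⟨ p , q , r ⟩) ∎
  where
  summand : Pattern → ℤ
  summand t = A (ρ ⊕ content r t)
  highest : Pattern
  highest = p , 0 , 0 , q , 0
  highest-dominant : IsDominantPattern 2 1 0 p q r highest
  highest-dominant =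
      ( trans (+-identityʳ (p + 0)) (+-identityʳ p) , +-identityʳ q
      , ≤-trans q≤p (m≤m+n p 0) , ≤-trans q≤p (m≤m+n p 0) , r≤q)
    , s≤s z≤n , s≤s (s≤s z≤n) , s≤s z≤n
  highest≡ : ∀ t → IsDominantPattern 2 1 0 p q r t → highest ≡ t
  highest≡ (a , zero , zero , d , zero) ((refl , refl , _) , _) =
    cong₂ (λ a d → a , 0 , 0 , d , 0) (trans (+-identityʳ (a + 0)) (+-identityʳ a)) (+-identityʳ d)
  highest≡ (_ , zero , zero , _ , suc _) (_ , _ , _ , s≤s ())
  highest≡ (_ , zero , suc _ , _)        (_ , s≤s () , _)
  highest≡ (_ , suc _ , _)               (_ , _ , s≤s (s≤s ()) , _)

-- Semistandard tableaux

words-unique : ∀ n k → Unique (words n k)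
words-unique n zero    = [] ∷ []
words-unique n (suc k) =
  Uniqueₚ.cartesianProductWith⁺ _∷_ Listₚ.∷-injective (Uniqueₚ.allFin⁺ n) (words-unique n k)

fillings-unique : ∀ n ps → Unique (fillings n ps)
fillings-unique n []       = [] ∷ []
fillings-unique n (p ∷ ps) =
  Uniqueₚ.cartesianProductWith⁺ _∷_ Listₚ.∷-injective (words-unique n p) (fillings-unique n ps)

∈-words⁺ : (w : List (Fin n)) → w ∈ words n (length w)
∈-words⁺ []      = here refl
∈-words⁺ (i ∷ w) = ∈-cartesianProductWith⁺ _∷_ (∈-allFin i) (∈-words⁺ w)

∈-words⁻ : ∀ k {w} → w ∈ words n k → length w ≡ k
∈-words⁻ zero    (here refl) = refl
∈-words⁻ (suc k) w∈
  with _ , _ , _ , w′∈ , refl ← ∈-cartesianProductWith⁻ _∷_ (allFin _) (words _ k) w∈ =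
  cong suc (∈-words⁻ k w′∈)

∈-fillings⁺ : (T : Filling n) → T ∈ fillings n (map length T)
∈-fillings⁺ []      = here refl
∈-fillings⁺ (w ∷ T) = ∈-cartesianProductWith⁺ _∷_ (∈-words⁺ w) (∈-fillings⁺ T)

∈-fillings⁻ : ∀ ps {T} → T ∈ fillings n ps → map length T ≡ ps
∈-fillings⁻ []       (here refl) = refl
∈-fillings⁻ (p ∷ ps) T∈
  with _ , _ , w∈ , T′∈ , refl ← ∈-cartesianProductWith⁻ _∷_ (words _ p) (fillings _ ps) T∈ =
  cong₂ _∷_ (∈-words⁻ p w∈) (∈-fillings⁻ ps T′∈)

tableaux : ∀ n → List ℕ → List (Filling n)
tableaux n ps = filter semiStandard? (fillings n ps)

tableaux-unique : ∀ n ps → Unique (tableaux n ps)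
tableaux-unique n ps = Uniqueₚ.filter⁺ semiStandard? (fillings-unique n ps)

∈-tableaux⁺ : {T : Filling n} → SemiStandard T → T ∈ tableaux n (map length T)
∈-tableaux⁺ {T = T} T-ss = ∈-filter⁺ semiStandard? (∈-fillings⁺ T) T-ss

∈-tableaux⁻ : ∀ ps {T : Filling n} → T ∈ tableaux n ps → map length T ≡ ps × SemiStandard T
∈-tableaux⁻ {n} ps T∈ with T∈fillings , T-ss ← ∈-filter⁻ semiStandard? {xs = fillings n ps} T∈ =
  ∈-fillings⁻ ps T∈fillings , T-ss

occurrences : Fin n → List (Fin n) → ℕ
occurrences i w = length (filter (i Fin.≟_) w)

occurrences-++ : ∀ (i : Fin n) v w → occurrences i (v ++ w) ≡ occurrences i v + occurrences i w
occurrences-++ i v w =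
  trans (cong length (Listₚ.filter-++ (i Fin.≟_) v w)) (Listₚ.length-++ (filter (i Fin.≟_) v))

wordWeight : List (Fin n) → Vec ℕ n
wordWeight w = Vec.tabulate (λ i → occurrences i w)

wordWeight-++ : (v w : List (Fin n)) → wordWeight (v ++ w) ≡ wordWeight v ⊕ wordWeight w
wordWeight-++ v w = trans (Vecₚ.tabulate-cong (λ i → occurrences-++ i v w)) (tabulate-⊕ _ _)
  where
  tabulate-⊕ : ∀ (f g : Fin n → ℕ) → Vec.tabulate (λ i → f i + g i) ≡ Vec.tabulate f ⊕ Vec.tabulate g
  tabulate-⊕ {zero}  f g = refl
  tabulate-⊕ {suc n} f g = cong (f 0F + g 0F Vec.∷_) (tabulate-⊕ (f ∘ Fin.suc) (g ∘ Fin.suc))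

Linked-∷ʳ⁺ : ∀ {R : A → A → Set} {y} → (∀ x → R x y) → Linked R xs → Linked R (xs ∷ʳ y)
Linked-∷ʳ⁺ Rxy []         = [-]
Linked-∷ʳ⁺ Rxy [-]        = Rxy _ ∷ [-]
Linked-∷ʳ⁺ Rxy (rx ∷ rxs) = rx ∷ Linked-∷ʳ⁺ Rxy rxs

Linked-∷ʳ⁻ : ∀ {R : A → A → Set} xs {y} → Linked R (xs ∷ʳ y) → Linked R xs
Linked-∷ʳ⁻ []           _          = []
Linked-∷ʳ⁻ (x ∷ [])     _          = [-]
Linked-∷ʳ⁻ (x ∷ z ∷ xs) (rx ∷ rxs) = rx ∷ Linked-∷ʳ⁻ (z ∷ xs) rxs

Above-[] : (u : List (Fin n)) → u Above []
Above-[] []      = []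
Above-[] (_ ∷ _) = []

∑-tableaux-∷ʳ-0 : ∀ ps (f : Vec ℕ n → ℤ) →
  ∑ (tableaux n ps) (f ∘ weight) ≡ ∑ (tableaux n (ps ∷ʳ 0)) (f ∘ weight)
∑-tableaux-∷ʳ-0 {n} ps f = begin
  ∑ (tableaux n ps) (f ∘ weight)
    ≡⟨ ∑-cong (tableaux n ps) (λ T → cong f (weight-∷ʳ-[] T)) ⟨
  (∑[ T ∈ tableaux n ps ] f (weight (T ∷ʳ [])))
    ≡⟨ ∑-map (_∷ʳ []) (tableaux n ps) (f ∘ weight) ⟨
  ∑ (map (_∷ʳ []) (tableaux n ps)) (f ∘ weight)
    ≡⟨ ∑-↭ (f ∘ weight) (unique∧set⇒↭
         (Uniqueₚ.map⁺ (λ {T} → Listₚ.∷ʳ-injectiveˡ T _) (tableaux-unique n ps))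
         (tableaux-unique n (ps ∷ʳ 0)) (mk⇔ to from)) ⟩
  ∑ (tableaux n (ps ∷ʳ 0)) (f ∘ weight) ∎
  where
  []≢∷ʳ : ∀ {ps : List ℕ} {p} → [] ≢ ps ∷ʳ p
  []≢∷ʳ {[]}    ()
  []≢∷ʳ {_ ∷ _} ()
  weight-∷ʳ-[] : (T : Filling n) → weight (T ∷ʳ []) ≡ weight T
  weight-∷ʳ-[] T = cong wordWeight
    (trans (sym (Listₚ.concat-++ T ([] ∷ []))) (Listₚ.++-identityʳ (concat T)))
  to : ∀ {T} → T ∈ map (_∷ʳ []) (tableaux n ps) → T ∈ tableaux n (ps ∷ʳ 0)
  to T∈ with T , T∈tableaux , refl ← ∈-map⁻ (_∷ʳ []) T∈
    with refl , sorted , columns ← ∈-tableaux⁻ ps T∈tableaux =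
    subst (λ qs → T ∷ʳ [] ∈ tableaux n qs) (Listₚ.map-++ length T ([] ∷ []))
      (∈-tableaux⁺ (Allₚ.∷ʳ⁺ sorted [] , Linked-∷ʳ⁺ Above-[] columns))
  from : ∀ {T} → T ∈ tableaux n (ps ∷ʳ 0) → T ∈ map (_∷ʳ []) (tableaux n ps)
  from {T} T∈ with initLast T | ∈-tableaux⁻ (ps ∷ʳ 0) T∈
  ... | []       | lengths , _ = contradiction lengths []≢∷ʳ
  ... | T′ ∷ʳ′ u | lengths , sorted , columns
    with refl , u≡[] ← Listₚ.∷ʳ-injective (map length T′) ps
                         (trans (sym (Listₚ.map-++ length T′ (u ∷ []))) lengths)
    with [] ← u = ∈-map⁺ (_∷ʳ []) (∈-tableaux⁺ (proj₁ (Allₚ.∷ʳ⁻ sorted) , Linked-∷ʳ⁻ T′ columns))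

∑-schur-padded : ∀ κ (f : Vec ℕ 3 → ℤ) → ℓ κ ≤ 3 →
  ∑ (schur 3 κ) f ≡ ∑ (tableaux 3 (κ ₁ ∷ κ ₂ ∷ κ ₃ ∷ [])) (f ∘ weight)
∑-schur-padded κ f ℓ≤3 = trans (∑-map weight (ssyt 3 κ) f) (pad (parts κ) ℓ≤3)
  where
  append : ∀ ps → ∑ (tableaux 3 ps) (f ∘ weight) ≡ ∑ (tableaux 3 (ps ∷ʳ 0)) (f ∘ weight)
  append ps = ∑-tableaux-∷ʳ-0 ps f
  pad : ∀ ps → length ps ≤ 3 →
    ∑ (tableaux 3 ps) (f ∘ weight) ≡ ∑ (tableaux 3 (nth ps 0 ∷ nth ps 1 ∷ nth ps 2 ∷ [])) (f ∘ weight)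
  pad []           _ = trans (append []) (trans (append (0 ∷ [])) (append (0 ∷ 0 ∷ [])))
  pad (p ∷ [])     _ = trans (append (p ∷ [])) (append (p ∷ 0 ∷ []))
  pad (p ∷ q ∷ []) _ = append (p ∷ q ∷ [])
  pad (_ ∷ _ ∷ _ ∷ []) _ = refl
  pad (_ ∷ _ ∷ _ ∷ _ ∷ _) (s≤s (s≤s (s≤s ())))

row : ℕ → ℕ → ℕ → List (Fin 3)
row a b c = replicate a 0F ++ replicate b 1F ++ replicate c 2F

wordWeight-row : ∀ a b c → wordWeight (row a b c) ≡ ⟨ a , b , c ⟩
wordWeight-row (suc a) b       c       = cong (⟨ 1 , 0 , 0 ⟩ ⊕_) (wordWeight-row a b c)
wordWeight-row zero    (suc b) c       = cong (⟨ 0 , 1 , 0 ⟩ ⊕_) (wordWeight-row zero b c)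
wordWeight-row zero    zero    (suc c) = cong (⟨ 0 , 0 , 1 ⟩ ⊕_) (wordWeight-row zero zero c)
wordWeight-row zero    zero    zero    = refl

length-row : ∀ a b c → length (row a b c) ≡ a + b + c
length-row (suc a) b       c = cong suc (length-row a b c)
length-row zero    (suc b) c = cong suc (length-row zero b c)
length-row zero    zero    c = Listₚ.length-replicate c

row-sorted : ∀ a b c → Linked Fin._≤_ (row a b c)
row-sorted a b c = Linkedₚ.AllPairs⇒Linked (weaklyIncreasing a b c)
  where
  weaklyIncreasing : ∀ a b c → AllPairs Fin._≤_ (row a b c)
  weaklyIncreasing (suc a) b       c       = All.universal (λ _ → z≤n) _ ∷ weaklyIncreasing a b c
  weaklyIncreasing zero    (suc b) c       =
    Allₚ.++⁺ (Allₚ.replicate⁺ b (s≤s z≤n)) (Allₚ.replicate⁺ c (s≤s z≤n)) ∷ weaklyIncreasing zero b c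
  weaklyIncreasing zero    zero    (suc c) =
    Allₚ.replicate⁺ c (s≤s (s≤s z≤n)) ∷ weaklyIncreasing zero zero c
  weaklyIncreasing zero    zero    zero    = []

sorted⇒row : (w : List (Fin 3)) → Linked Fin._≤_ w → ∃[ a ] ∃[ b ] ∃[ c ] w ≡ row a b c
sorted⇒row []      _      = 0 , 0 , 0 , refl
sorted⇒row (i ∷ w) sorted with sorted⇒row w (Linked.tail sorted)
sorted⇒row (0F ∷ _) _            | a , b , c , refl          = suc a , b , c , refl
sorted⇒row (1F ∷ _) _            | zero , b , c , refl       = 0 , suc b , c , refl
sorted⇒row (2F ∷ _) _            | zero , zero , c , refl    = 0 , 0 , suc c , refl
sorted⇒row (1F ∷ _) (() ∷ _)     | suc _ , _ , _ , refl
sorted⇒row (2F ∷ _) (() ∷ _)     | suc _ , _ , _ , refl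
sorted⇒row (2F ∷ _) (s≤s () ∷ _) | zero , suc _ , _ , refl

row-Above⁻ : ∀ a b c a′ b′ c′ → a′ + b′ + c′ ≤ a + b + c → row a b c Above row a′ b′ c′ →
             a′ ≡ 0 × b′ ≤ a × b′ + c′ ≤ a + b
row-Above⁻ a       b       c       zero     zero     zero     _       _           = refl , z≤n , z≤n
row-Above⁻ (suc a) b       c       zero     zero     (suc c′) length≤ (_ ∷ above) =
  refl , z≤n , s≤s (proj₂ (proj₂ (row-Above⁻ a b c zero zero c′ (s≤s⁻¹ length≤) above)))
row-Above⁻ zero    (suc b) c       zero     zero     (suc c′) length≤ (_ ∷ above) =
  refl , z≤n , s≤s (proj₂ (proj₂ (row-Above⁻ zero b c zero zero c′ (s≤s⁻¹ length≤) above)))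
row-Above⁻ (suc a) b       c       zero     (suc b′) c′       length≤ (_ ∷ above)
  with _ , b′≤a , b′+c′≤a+b ← row-Above⁻ a b c zero b′ c′ (s≤s⁻¹ length≤) above =
  refl , s≤s b′≤a , s≤s b′+c′≤a+b
row-Above⁻ zero    zero    (suc c) zero     zero     (suc c′) _       (s≤s (s≤s ()) ∷ _)
row-Above⁻ zero    (suc b) c       zero     (suc b′) c′       _       (s≤s () ∷ _)
row-Above⁻ zero    zero    (suc c) zero     (suc b′) c′       _       (s≤s () ∷ _)
row-Above⁻ (suc a) b       c       (suc a′) b′       c′       _       (() ∷ _)
row-Above⁻ zero    (suc b) c       (suc a′) b′       c′       _       (() ∷ _)
row-Above⁻ zero    zero    (suc c) (suc a′) b′       c′       _       (() ∷ _)

row-Above⁺ : ∀ a b c b′ c′ → b′ ≤ a → b′ + c′ ≤ a + b → row a b c Above row 0 b′ c′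
row-Above⁺ a       b       c zero     zero     _          _               = Above-[] (row a b c)
row-Above⁺ (suc a) b       c zero     (suc c′) _          (s≤s b′+c′≤a+b) =
  s≤s z≤n ∷ row-Above⁺ a b c zero c′ z≤n b′+c′≤a+b
row-Above⁺ zero    (suc b) c zero     (suc c′) _          (s≤s b′+c′≤a+b) =
  s≤s (s≤s z≤n) ∷ row-Above⁺ zero b c zero c′ z≤n b′+c′≤a+b
row-Above⁺ (suc a) b       c (suc b′) c′       (s≤s b′≤a) (s≤s b′+c′≤a+b) =
  s≤s z≤n ∷ row-Above⁺ a b c b′ c′ b′≤a b′+c′≤a+b

tableau : ℕ → Pattern → Filling 3
tableau r (a , b , c , d , e) = row a b c ∷ row 0 d e ∷ row 0 0 r ∷ []

weight-tableau : ∀ r t → weight (tableau r t) ≡ content r t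
weight-tableau r (a , b , c , d , e) = begin
  wordWeight (row a b c ++ (row 0 d e ++ (row 0 0 r ++ [])))
    ≡⟨ wordWeight-++ (row a b c) _ ⟩
  wordWeight (row a b c) ⊕ wordWeight (row 0 d e ++ (row 0 0 r ++ []))
    ≡⟨ cong (wordWeight (row a b c) ⊕_) (wordWeight-++ (row 0 d e) _) ⟩
  wordWeight (row a b c) ⊕ (wordWeight (row 0 d e) ⊕ wordWeight (row 0 0 r ++ []))
    ≡⟨ cong₂ _⊕_ (wordWeight-row a b c) (cong₂ _⊕_ (wordWeight-row 0 d e)
         (trans (cong wordWeight (Listₚ.++-identityʳ (row 0 0 r))) (wordWeight-row 0 0 r))) ⟩
  ⟨ a + 0 , b + (d + 0) , c + (e + r) ⟩
    ≡⟨ ⟨⟩-cong (+-identityʳ a) (cong (_+_ b) (+-identityʳ d)) refl ⟩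
  ⟨ a , b + d , c + (e + r) ⟩ ∎

row-injective : ∀ a b c a′ b′ c′ → row a b c ≡ row a′ b′ c′ → (a , b , c) ≡ (a′ , b′ , c′)
row-injective a b c a′ b′ c′ eq
  with refl ← trans (sym (wordWeight-row a b c))
                    (trans (cong wordWeight eq) (wordWeight-row a′ b′ c′)) = refl

tableau-injective : ∀ {t t′} → tableau r t ≡ tableau r t′ → t ≡ t′
tableau-injective {t = a , b , c , d , e} {a′ , b′ , c′ , d′ , e′} eq
  with row₁ , eq′ ← Listₚ.∷-injective eq
  with refl ← row-injective a b c a′ b′ c′ row₁
     | refl ← row-injective 0 d e 0 d′ e′ (Listₚ.∷-injectiveˡ eq′) = refl

tableau-∈-tableaux : ∀ {t} → IsPattern p q r t → tableau r t ∈ tableaux 3 (p ∷ q ∷ r ∷ [])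
tableau-∈-tableaux {p} {q} {r} {t@(a , b , c , d , e)} t-pattern@(row₁ , row₂ , q≤a+b , _ , r≤d) =
  subst (λ ps → tableau r t ∈ tableaux 3 ps) lengths (∈-tableaux⁺
    ( row-sorted a b c ∷ row-sorted 0 d e ∷ row-sorted 0 0 r ∷ []
    , row-Above⁺ a b c d e (isPattern⇒d≤a t t-pattern) (subst (_≤ a + b) (sym row₂) q≤a+b)
    ∷ row-Above⁺ 0 d e 0 r z≤n r≤d
    ∷ [-]))
  where
  lengths : map length (tableau r t) ≡ p ∷ q ∷ r ∷ []
  lengths = cong₂ _∷_ (trans (length-row a b c) row₁)
    (cong₂ _∷_ (trans (length-row 0 d e) row₂) (cong (_∷ []) (length-row 0 0 r)))

∈-tableaux⇒tableau : q ≤ p → r ≤ q → ∀ {T} → T ∈ tableaux 3 (p ∷ q ∷ r ∷ []) →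
                     ∃[ t ] IsPattern p q r t × T ≡ tableau r t
∈-tableaux⇒tableau {q} {p} {r} q≤p r≤q {T} T∈ with ∈-tableaux⁻ (p ∷ q ∷ r ∷ []) T∈
∈-tableaux⇒tableau q≤p r≤q {u ∷ v ∷ w ∷ []} T∈
  | refl , (u-sorted ∷ v-sorted ∷ w-sorted ∷ []) , (u-above-v ∷ v-above-w ∷ [-])
  with a , b , c , refl ← sorted⇒row u u-sorted
     | a′ , d , e , refl ← sorted⇒row v v-sorted
     | a″ , d″ , r , refl ← sorted⇒row w w-sorted
  rewrite length-row a b c | length-row a′ d e | length-row a″ d″ r
  with refl , d≤a , d+e≤a+b ← row-Above⁻ a b c a′ d e q≤p u-above-v
  with refl , z≤n , r≤d ← row-Above⁻ 0 d e a″ d″ r r≤q v-above-w =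
  (a , b , c , d , e) , (refl , refl , d+e≤a+b , +-monoˡ-≤ e d≤a , r≤d) , refl

κ₂≤κ₁ : ∀ κ → κ ₂ ≤ κ ₁
κ₂≤κ₁ (mkPartition []          _       _) = z≤n
κ₂≤κ₁ (mkPartition (_ ∷ [])    _       _) = z≤n
κ₂≤κ₁ (mkPartition (_ ∷ _ ∷ _) (q ∷ _) _) = q

κ₃≤κ₂ : ∀ κ → κ ₃ ≤ κ ₂
κ₃≤κ₂ (mkPartition []              _           _) = z≤n
κ₃≤κ₂ (mkPartition (_ ∷ [])        _           _) = z≤n
κ₃≤κ₂ (mkPartition (_ ∷ _ ∷ [])    _           _) = z≤n
κ₃≤κ₂ (mkPartition (_ ∷ _ ∷ _ ∷ _) (_ ∷ q ∷ _) _) = q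

module _ (κ : Partition) (ℓ≤3 : ℓ κ ≤ 3) where
  private
    κ-parts : List ℕ
    κ-parts = κ ₁ ∷ κ ₂ ∷ κ ₃ ∷ []

    κ-patterns : List Pattern
    κ-patterns = patterns (κ ₁) (κ ₂) (κ ₃)

    tableaux-↭-patterns : tableaux 3 κ-parts ↭ map (tableau (κ ₃)) κ-patterns
    tableaux-↭-patterns = unique∧set⇒↭ (tableaux-unique 3 κ-parts)
      (Uniqueₚ.map⁺ tableau-injective (patterns-unique (κ ₁) (κ ₂) (κ ₃))) (mk⇔ to from)
      where
      to : ∀ {T} → T ∈ tableaux 3 κ-parts → T ∈ map (tableau (κ ₃)) κ-patterns
      to T∈ with t , t-pattern , refl ← ∈-tableaux⇒tableau {κ ₂} {κ ₁} {κ ₃} (κ₂≤κ₁ κ) (κ₃≤κ₂ κ) T∈ =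
        ∈-map⁺ (tableau (κ ₃)) (∈-patterns⁺ t-pattern)
      from : ∀ {T} → T ∈ map (tableau (κ ₃)) κ-patterns → T ∈ tableaux 3 κ-parts
      from T∈ with t , t∈ , refl ← ∈-map⁻ (tableau (κ ₃)) T∈ = tableau-∈-tableaux (∈-patterns⁻ t∈)

  ∑-schur-patterns : ∀ (f : Vec ℕ 3 → ℤ) →
    ∑ (schur 3 κ) f ≡ ∑ (patterns (κ ₁) (κ ₂) (κ ₃)) (f ∘ content (κ ₃))
  ∑-schur-patterns f = begin
    ∑ (schur 3 κ) f                                   ≡⟨ ∑-schur-padded κ f ℓ≤3 ⟩
    ∑ (tableaux 3 κ-parts) (f ∘ weight)               ≡⟨ ∑-↭ (f ∘ weight) tableaux-↭-patterns ⟩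
    ∑ (map (tableau (κ ₃)) κ-patterns) (f ∘ weight)   ≡⟨ ∑-map (tableau (κ ₃)) κ-patterns (f ∘ weight) ⟩
    (∑[ t ∈ κ-patterns ] f (weight (tableau (κ ₃) t)))
      ≡⟨ ∑-cong κ-patterns (λ t → cong f (weight-tableau (κ ₃) t)) ⟩
    ∑ κ-patterns (f ∘ content (κ ₃))                  ∎

-- Schur polynomials in three variables

column-bound : ∀ {i : Fin n} {u} T → All (0 <_) (map length T) → Linked _Above_ ((i ∷ u) ∷ T) →
               toℕ i + length T < n
column-bound {n} {i} []            []               _               =
  subst (_< n) (sym (+-identityʳ (toℕ i))) (Finₚ.toℕ<n i)
column-bound {n} {i} ((j ∷ v) ∷ T) (_ ∷ nonempty) ((i<j ∷ _) ∷ columns) =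
  ≤-<-trans (subst (_≤ toℕ j + length T) (sym (+-suc (toℕ i) (length T))) (+-monoˡ-≤ (length T) i<j))
            (column-bound T nonempty columns)

schur-vanishes : ∀ κ → n < ℓ κ → schur n κ ≡ []
schur-vanishes {n} κ n<ℓ = cong (map weight) (Listₚ.filter-none semiStandard?
  (All.tabulate λ T∈ T-ss → <⇒≱ n<ℓ (short (∈-fillings⁻ (parts κ) T∈) T-ss)))
  where
  short : ∀ {T : Filling n} → map length T ≡ parts κ → SemiStandard T → ℓ κ ≤ n
  short {[]}          lengths _ = subst (λ ps → length ps ≤ n) lengths z≤n
  short {[] ∷ T}      lengths _ with () ∷ _ ← subst (All (0 <_)) (sym lengths) (positive κ)
  short {(i ∷ u) ∷ T} lengths (_ , columns)
    with _ ∷ nonempty ← subst (All (0 <_)) (sym lengths) (positive κ) =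
    subst (_≤ n) (trans (sym (cong suc (Listₚ.length-map length T))) (cong length lengths))
      (≤-<-trans (m≤n+m (length T) (toℕ i)) (column-bound T nonempty columns))

⟦_⟧ : Partition → Vec ℕ 3
⟦ κ ⟧ = ⟨ κ ₁ , κ ₂ , κ ₃ ⟩

module _ (κ : Partition) (ℓ≤3 : ℓ κ ≤ 3) where

  schur-swap₁₂ : ∀ f → ∑ (schur 3 κ) (f ∘ swap₁₂) ≡ ∑ (schur 3 κ) f
  schur-swap₁₂ f = trans (∑-schur-patterns κ ℓ≤3 (f ∘ swap₁₂))
    (trans (∑-patterns-swap₁₂ (κ ₁) (κ ₂) (κ ₃) f) (sym (∑-schur-patterns κ ℓ≤3 f)))

  schur-swap₂₃ : ∀ f → ∑ (schur 3 κ) (f ∘ swap₂₃) ≡ ∑ (schur 3 κ) f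
  schur-swap₂₃ f = trans (∑-schur-patterns κ ℓ≤3 (f ∘ swap₂₃))
    (trans (∑-patterns-swap₂₃ (κ ₁) (κ ₂) (κ ₃) f) (sym (∑-schur-patterns κ ℓ≤3 f)))

  schur-convolution-alternating : ∀ {A} → Alternating A →
                                  Alternating (λ v → ∑[ m ∈ schur 3 κ ] A (v ⊕ m))
  schur-convolution-alternating {A} A-alternating = record
    { alternating₁₂ = reverses swap₁₂ swap₁₂-⊕ schur-swap₁₂ (alternating₁₂ A-alternating)
    ; alternating₂₃ = reverses swap₂₃ swap₂₃-⊕ schur-swap₂₃ (alternating₂₃ A-alternating)
    }
    where
    swap₁₂-⊕ : ∀ u v → swap₁₂ u ⊕ swap₁₂ v ≡ swap₁₂ (u ⊕ v)
    swap₁₂-⊕ ⟨ _ , _ , _ ⟩ ⟨ _ , _ , _ ⟩ = refl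
    swap₂₃-⊕ : ∀ u v → swap₂₃ u ⊕ swap₂₃ v ≡ swap₂₃ (u ⊕ v)
    swap₂₃-⊕ ⟨ _ , _ , _ ⟩ ⟨ _ , _ , _ ⟩ = refl
    reverses : ∀ (swap : Vec ℕ 3 → Vec ℕ 3) → (∀ u v → swap u ⊕ swap v ≡ swap (u ⊕ v)) →
      (∀ f → ∑ (schur 3 κ) (f ∘ swap) ≡ ∑ (schur 3 κ) f) → (∀ v → A (swap v) ≡ ℤ.- A v) →
      ∀ v → ∑[ m ∈ schur 3 κ ] A (swap v ⊕ m) ≡ ℤ.- (∑[ m ∈ schur 3 κ ] A (v ⊕ m))
    reverses swap swap-⊕ schur-swap A-swap v = begin
      (∑[ m ∈ schur 3 κ ] A (swap v ⊕ m))
        ≡⟨ schur-swap (λ m → A (swap v ⊕ m)) ⟨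
      (∑[ m ∈ schur 3 κ ] A (swap v ⊕ swap m))
        ≡⟨ ∑-cong (schur 3 κ) (λ m → trans (cong A (swap-⊕ v m)) (A-swap (v ⊕ m))) ⟩
      (∑[ m ∈ schur 3 κ ] (ℤ.- A (v ⊕ m)))
        ≡⟨ ∑-neg (schur 3 κ) (λ m → A (v ⊕ m)) ⟩
      ℤ.- (∑[ m ∈ schur 3 κ ] A (v ⊕ m)) ∎

  schur-bialternant : ∀ {A} → Alternating A → ∑[ m ∈ schur 3 κ ] A (ρ ⊕ m) ≡ A (ρ ⊕ ⟦ κ ⟧)
  schur-bialternant {A} A-alternating =
    trans (∑-schur-patterns κ ℓ≤3 (λ m → A (ρ ⊕ m))) (bialternant A-alternating (κ₂≤κ₁ κ) (κ₃≤κ₂ κ))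

-- Coefficients of Schur expansions

infix 4 _≟ᵥ_

_≟ᵥ_ : DecidableEquality (Vec ℕ n)
_≟ᵥ_ = Vecₚ.≡-dec _≟_

coeff-∑ : ∀ (α : Vec ℕ n) P → + coeff α P ≡ ∑[ m ∈ P ] 𝟙 (α ≟ᵥ m)
coeff-∑ α P = begin
  + coeff α P                       ≡⟨ ∑-1 (filter (α ≟ᵥ_) P) ⟨
  (∑[ _ ∈ filter (α ≟ᵥ_) P ] 1ℤ)    ≡⟨ ∑-𝟙 (α ≟ᵥ_) P ⟨
  (∑[ m ∈ P ] 𝟙 (α ≟ᵥ m))           ∎

∑-coeff : ∀ {S : List (Vec ℕ n)} → Unique S → ∀ P → (∀ {m} → m ∈ P → m ∈ S) → ∀ f →
          ∑ P f ≡ ∑[ α ∈ S ] (+ coeff α P ℤ.* f α)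
∑-coeff {S = S} S! P P⊆S f = sym (begin
  (∑[ α ∈ S ] (+ coeff α P ℤ.* f α))
    ≡⟨ ∑-cong S (λ α → cong (ℤ._* f α) (coeff-∑ α P)) ⟩
  (∑[ α ∈ S ] ((∑[ m ∈ P ] 𝟙 (α ≟ᵥ m)) ℤ.* f α))
    ≡⟨ ∑-cong S (λ α → ∑-*ʳ (f α) P (λ m → 𝟙 (α ≟ᵥ m))) ⟨
  (∑[ α ∈ S ] ∑[ m ∈ P ] (𝟙 (α ≟ᵥ m) ℤ.* f α))
    ≡⟨ ∑-swap S P (λ α m → 𝟙 (α ≟ᵥ m) ℤ.* f α) ⟩
  (∑[ m ∈ P ] ∑[ α ∈ S ] (𝟙 (α ≟ᵥ m) ℤ.* f α))
    ≡⟨ ∑-cong-∈ P (λ m∈P → pick (P⊆S m∈P)) ⟩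
  ∑ P f ∎)
  where
  pick : ∀ {m} → m ∈ S → ∑[ α ∈ S ] (𝟙 (α ≟ᵥ m) ℤ.* f α) ≡ f m
  pick {m} m∈S = begin
    (∑[ α ∈ S ] (𝟙 (α ≟ᵥ m) ℤ.* f α))
      ≡⟨ ∑-𝟙-* (_≟ᵥ m) S f ⟩
    ∑ (filter (_≟ᵥ m) S) f
      ≡⟨ ∑-↭ f (∃!-∈⇒↭ (Uniqueₚ.filter⁺ (_≟ᵥ m) S!)
           (m , ∈-filter⁺ (_≟ᵥ m) m∈S refl , λ α∈ → sym (proj₂ (∈-filter⁻ (_≟ᵥ m) {xs = S} α∈)))) ⟩
    f m ℤ.+ 0ℤ
      ≡⟨ ℤₚ.+-identityʳ (f m) ⟩
    f m ∎

schurExpansion-pairing : ∀ {μ ν L} → IsSchurExpansion μ ν L → ∀ (f : Vec ℕ n → ℤ) →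
  ∑ (schur n μ ⊗ schur n ν) f ≡ ∑ L (λ (a , κ) → a ℤ.* ∑ (schur n κ) f)
schurExpansion-pairing {n} {μ} {ν} {L} isExpansion f = begin
  ∑ product f
    ≡⟨ ∑-coeff S! product (λ m∈ → ∈-deduplicate⁺ _≟ᵥ_ (∈-++⁺ˡ m∈)) f ⟩
  (∑[ α ∈ S ] (+ coeff α product ℤ.* f α))
    ≡⟨ ∑-cong S (λ α → cong (ℤ._* f α) (isExpansion n α)) ⟩
  (∑[ α ∈ S ] (evalCoeff α L ℤ.* f α))
    ≡⟨ ∑-cong S (λ α → ∑-*ʳ (f α) L (λ (a , κ) → a ℤ.* (+ coeff α (schur n κ)))) ⟨
  (∑[ α ∈ S ] ∑ L (λ (a , κ) → a ℤ.* (+ coeff α (schur n κ)) ℤ.* f α))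
    ≡⟨ ∑-swap S L (λ α (a , κ) → a ℤ.* (+ coeff α (schur n κ)) ℤ.* f α) ⟩
  ∑ L (λ (a , κ) → ∑[ α ∈ S ] (a ℤ.* (+ coeff α (schur n κ)) ℤ.* f α))
    ≡⟨ ∑-cong-∈ L term ⟩
  ∑ L (λ (a , κ) → a ℤ.* ∑ (schur n κ) f) ∎
  where
  product : Poly n
  product = schur n μ ⊗ schur n ν
  S : List (Vec ℕ n)
  S = deduplicate _≟ᵥ_ (product ++ concatMap (schur n ∘ proj₂) L)
  S! : Unique S
  S! = DecUniqueₚ.deduplicate-! _≟ᵥ_ _
  term : ∀ {(a , κ) : ℤ × Partition} → (a , κ) ∈ L →
    ∑[ α ∈ S ] (a ℤ.* (+ coeff α (schur n κ)) ℤ.* f α) ≡ a ℤ.* ∑ (schur n κ) f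
  term {a , κ} aκ∈L = begin
    (∑[ α ∈ S ] (a ℤ.* (+ coeff α (schur n κ)) ℤ.* f α))
      ≡⟨ ∑-cong S (λ α → ℤₚ.*-assoc a _ (f α)) ⟩
    (∑[ α ∈ S ] (a ℤ.* (+ coeff α (schur n κ) ℤ.* f α)))
      ≡⟨ ∑-*ˡ a S (λ α → + coeff α (schur n κ) ℤ.* f α) ⟩
    a ℤ.* (∑[ α ∈ S ] (+ coeff α (schur n κ) ℤ.* f α))
      ≡⟨ cong (a ℤ.*_) (∑-coeff S! (schur n κ) (λ m∈ → ∈-deduplicate⁺ _≟ᵥ_
           (∈-++⁺ʳ product (∈-concatMap⁺ (schur n ∘ proj₂) (lose aκ∈L m∈)))) f) ⟨
    a ℤ.* ∑ (schur n κ) f ∎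

alternant : (Vec ℕ 3 → ℤ) → Vec ℕ 3 → ℤ
alternant φ ⟨ x , y , z ⟩ =
  φ ⟨ x , y , z ⟩ ℤ.- φ ⟨ x , z , y ⟩ ℤ.- φ ⟨ y , x , z ⟩
  ℤ.+ φ ⟨ y , z , x ⟩ ℤ.+ φ ⟨ z , x , y ⟩ ℤ.- φ ⟨ z , y , x ⟩

alternant-alternating : ∀ φ → Alternating (alternant φ)
alternant-alternating φ = record
  { alternating₁₂ = λ { ⟨ x , y , z ⟩ → reverse₁₂ (φ ⟨ x , y , z ⟩) (φ ⟨ x , z , y ⟩) (φ ⟨ y , x , z ⟩)
                                                  (φ ⟨ y , z , x ⟩) (φ ⟨ z , x , y ⟩) (φ ⟨ z , y , x ⟩) }
  ; alternating₂₃ = λ { ⟨ x , y , z ⟩ → reverse₂₃ (φ ⟨ x , y , z ⟩) (φ ⟨ x , z , y ⟩) (φ ⟨ y , x , z ⟩)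
                                                  (φ ⟨ y , z , x ⟩) (φ ⟨ z , x , y ⟩) (φ ⟨ z , y , x ⟩) }
  }
  where
  reverse₁₂ : ∀ a b c d e f →
    c ℤ.- d ℤ.- a ℤ.+ b ℤ.+ f ℤ.- e ≡ ℤ.- (a ℤ.- b ℤ.- c ℤ.+ d ℤ.+ e ℤ.- f)
  reverse₁₂ = ℤ-Ring.solve-∀
  reverse₂₃ : ∀ a b c d e f →
    b ℤ.- a ℤ.- e ℤ.+ f ℤ.+ c ℤ.- d ≡ ℤ.- (a ℤ.- b ℤ.- c ℤ.+ d ℤ.+ e ℤ.- f)
  reverse₂₃ = ℤ-Ring.solve-∀

Decreasing : Vec ℕ 3 → Set
Decreasing ⟨ x , y , z ⟩ = y < x × z < y

¬decreasing⇒𝟙≡0 : ∀ {v δ} → Decreasing δ → ¬ Decreasing v → 𝟙 (v ≟ᵥ δ) ≡ 0ℤ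
¬decreasing⇒𝟙≡0 {v} {δ} δ-decreasing ¬decreasing =
  𝟙-no (v ≟ᵥ δ) λ v≡δ → ¬decreasing (subst Decreasing (sym v≡δ) δ-decreasing)

alternant-𝟙 : ∀ {δ} → Decreasing δ → ∀ v → Decreasing v → alternant (λ u → 𝟙 (u ≟ᵥ δ)) v ≡ 𝟙 (v ≟ᵥ δ)
alternant-𝟙 {δ} δ-decreasing ⟨ x , y , z ⟩ (y<x , z<y)
  rewrite ¬decreasing⇒𝟙≡0 {⟨ x , z , y ⟩} δ-decreasing (λ (_ , y<z) → <-asym z<y y<z)
        | ¬decreasing⇒𝟙≡0 {⟨ y , x , z ⟩} δ-decreasing (λ (x<y , _) → <-asym y<x x<y)
        | ¬decreasing⇒𝟙≡0 {⟨ y , z , x ⟩} δ-decreasing (λ (_ , x<z) → <-asym (<-trans z<y y<x) x<z)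
        | ¬decreasing⇒𝟙≡0 {⟨ z , x , y ⟩} δ-decreasing (λ (x<z , _) → <-asym (<-trans z<y y<x) x<z)
        | ¬decreasing⇒𝟙≡0 {⟨ z , y , x ⟩} δ-decreasing (λ (y<z , _) → <-asym z<y y<z) =
  unit (𝟙 (⟨ x , y , z ⟩ ≟ᵥ δ))
  where
  unit : ∀ a → a ℤ.- 0ℤ ℤ.- 0ℤ ℤ.+ 0ℤ ℤ.+ 0ℤ ℤ.- 0ℤ ≡ a
  unit = ℤ-Ring.solve-∀

ρ⊕⟦_⟧-decreasing : ∀ κ → Decreasing (ρ ⊕ ⟦ κ ⟧)
ρ⊕⟦ κ ⟧-decreasing = s≤s (s≤s (κ₂≤κ₁ κ)) , s≤s (κ₃≤κ₂ κ)

parts-⟦⟧ : ∀ κ → ℓ κ ≤ 3 → parts κ ≡ takeWhile (0 <?_) (κ ₁ ∷ κ ₂ ∷ κ ₃ ∷ [])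
parts-⟦⟧ (mkPartition []               _ [])                                 _ = refl
parts-⟦⟧ (mkPartition (_ ∷ [])         _ (s≤s z≤n ∷ []))                     _ = refl
parts-⟦⟧ (mkPartition (_ ∷ _ ∷ [])     _ (s≤s z≤n ∷ s≤s z≤n ∷ []))           _ = refl
parts-⟦⟧ (mkPartition (_ ∷ _ ∷ _ ∷ []) _ (s≤s z≤n ∷ s≤s z≤n ∷ s≤s z≤n ∷ [])) _ = refl
parts-⟦⟧ (mkPartition (_ ∷ _ ∷ _ ∷ _ ∷ _) _ _) (s≤s (s≤s (s≤s ())))

ρ⊕⟦⟧-injective : ∀ κ κ′ → ℓ κ ≤ 3 → ℓ κ′ ≤ 3 → ρ ⊕ ⟦ κ ⟧ ≡ ρ ⊕ ⟦ κ′ ⟧ → parts κ ≡ parts κ′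
ρ⊕⟦⟧-injective κ κ′ ℓκ≤3 ℓκ′≤3 eq = begin
  parts κ                ≡⟨ parts-⟦⟧ κ ℓκ≤3 ⟩
  unpad (ρ ⊕ ⟦ κ ⟧)      ≡⟨ cong unpad eq ⟩
  unpad (ρ ⊕ ⟦ κ′ ⟧)     ≡⟨ parts-⟦⟧ κ′ ℓκ′≤3 ⟨
  parts κ′               ∎
  where
  unpad : Vec ℕ 3 → List ℕ
  unpad ⟨ x , y , z ⟩ = takeWhile (0 <?_) (x ∸ 2 ∷ y ∸ 1 ∷ z ∷ [])

infix 4 _≟ₚ_

_≟ₚ_ : ∀ κ κ′ → Dec (parts κ ≡ parts κ′)
κ ≟ₚ κ′ = Listₚ.≡-dec _≟_ (parts κ) (parts κ′)

-- For a symmetric polynomial P in three variables, ∑[ m ∈ P ] extract lam (ρ ⊕ m) is the coefficient of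
-- x^(λ+ρ) in the product of P and the Vandermonde determinant, and hence that of s_λ in P.
extract : Partition → Vec ℕ 3 → ℤ
extract lam = alternant (λ v → 𝟙 (v ≟ᵥ ρ ⊕ ⟦ lam ⟧))

extract-alternating : ∀ lam → Alternating (extract lam)
extract-alternating lam = alternant-alternating (λ v → 𝟙 (v ≟ᵥ ρ ⊕ ⟦ lam ⟧))

extract-decreasing : ∀ lam v → Decreasing v → extract lam v ≡ 𝟙 (v ≟ᵥ ρ ⊕ ⟦ lam ⟧)
extract-decreasing lam = alternant-𝟙 ρ⊕⟦ lam ⟧-decreasing

extract-schur : ∀ lam → ℓ lam ≤ 3 → ∀ κ → ∑[ m ∈ schur 3 κ ] extract lam (ρ ⊕ m) ≡ 𝟙 (lam ≟ₚ κ)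
extract-schur lam lam≤3 κ with ℓ κ ≤? 3
... | no ℓ≰3 = begin
  (∑[ m ∈ schur 3 κ ] extract lam (ρ ⊕ m))
    ≡⟨ cong (λ P → ∑[ m ∈ P ] extract lam (ρ ⊕ m)) (schur-vanishes κ (≰⇒> ℓ≰3)) ⟩
  0ℤ
    ≡⟨ 𝟙-no (lam ≟ₚ κ) (λ lam≡κ → ℓ≰3 (subst (λ ps → length ps ≤ 3) lam≡κ lam≤3)) ⟨
  𝟙 (lam ≟ₚ κ) ∎
... | yes ℓ≤3 = begin
  (∑[ m ∈ schur 3 κ ] extract lam (ρ ⊕ m))
    ≡⟨ schur-bialternant κ ℓ≤3 (extract-alternating lam) ⟩
  extract lam (ρ ⊕ ⟦ κ ⟧)
    ≡⟨ extract-decreasing lam (ρ ⊕ ⟦ κ ⟧) ρ⊕⟦ κ ⟧-decreasing ⟩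
  𝟙 (ρ ⊕ ⟦ κ ⟧ ≟ᵥ ρ ⊕ ⟦ lam ⟧)
    ≡⟨ 𝟙-cong _ (lam ≟ₚ κ) (ρ⊕⟦⟧-injective lam κ lam≤3 ℓ≤3 ∘ sym)
         (cong (λ ps → ρ ⊕ ⟨ nth ps 0 , nth ps 1 , nth ps 2 ⟩) ∘ sym) ⟩
  𝟙 (lam ≟ₚ κ) ∎

-- Littlewood–Richardson coefficients

lrCoefficient-pairing : ∀ lam μ ν {c} → ℓ lam ≤ 3 → ℓ μ ≤ 3 → ℓ ν ≤ 3 → IsLRCoefficient lam μ ν c →
  c ≡ ∑[ m ∈ schur 3 ν ] extract lam (ρ ⊕ ⟦ μ ⟧ ⊕ m)
lrCoefficient-pairing lam μ ν lam≤3 μ≤3 ν≤3 (L , isExpansion , refl) = begin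
  ∑ (filter (λ (_ , κ) → lam ≟ₚ κ) L) proj₁
    ≡⟨ ∑-𝟙-* (λ (_ , κ) → lam ≟ₚ κ) L proj₁ ⟨
  ∑ L (λ (a , κ) → 𝟙 (lam ≟ₚ κ) ℤ.* a)
    ≡⟨ ∑-cong L (λ (a , κ) → trans (ℤₚ.*-comm (𝟙 (lam ≟ₚ κ)) a)
         (cong (a ℤ.*_) (sym (extract-schur lam lam≤3 κ)))) ⟩
  ∑ L (λ (a , κ) → a ℤ.* (∑[ m ∈ schur 3 κ ] extract lam (ρ ⊕ m)))
    ≡⟨ schurExpansion-pairing {μ = μ} {ν} {L} isExpansion (λ m → extract lam (ρ ⊕ m)) ⟨
  (∑[ m ∈ schur 3 μ ⊗ schur 3 ν ] extract lam (ρ ⊕ m))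
    ≡⟨ ∑-cartesianProductWith _⊕_ (schur 3 μ) (schur 3 ν) (λ m → extract lam (ρ ⊕ m)) ⟩
  (∑[ m ∈ schur 3 μ ] ∑[ m′ ∈ schur 3 ν ] extract lam (ρ ⊕ (m ⊕ m′)))
    ≡⟨ ∑-cong (schur 3 μ) (λ m → ∑-cong (schur 3 ν) (λ m′ →
         cong (extract lam) (sym (Vecₚ.zipWith-assoc +-assoc ρ m m′)))) ⟩
  (∑[ m ∈ schur 3 μ ] ∑[ m′ ∈ schur 3 ν ] extract lam (ρ ⊕ m ⊕ m′))
    ≡⟨ schur-bialternant μ μ≤3 (schur-convolution-alternating ν ν≤3 (extract-alternating lam)) ⟩
  (∑[ m ∈ schur 3 ν ] extract lam (ρ ⊕ ⟦ μ ⟧ ⊕ m)) ∎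

dominantPattern-decreasing : ∀ {x y z t} → IsDominantPattern x y z p q r t →
                             Decreasing (⟨ x , y , z ⟩ ⊕ content r t)
dominantPattern-decreasing {r = r} {x} {y} {z} {t@(a , b , c , d , e)}
                           (t-pattern@(_ , _ , _ , _ , r≤d) , _ , b-fits , e-fits) =
    subst (_< x + a) (+-assoc y b d) (+-mono-<-≤ b-fits (isPattern⇒d≤a t t-pattern))
  , subst₂ _<_ (trans (+-assoc z (c + e) r) (cong (_+_ z) (+-assoc c e r))) (+-assoc y b d)
      (+-mono-<-≤ e-fits r≤d)

module _ (lam μ ν : Partition) where

  IsLRPattern : Pattern → Set
  IsLRPattern t =
    IsDominantPattern (2 + μ ₁) (1 + μ ₂) (μ ₃) (ν ₁) (ν ₂) (ν ₃) t ×
    ρ ⊕ ⟦ μ ⟧ ⊕ content (ν ₃) t ≡ ρ ⊕ ⟦ lam ⟧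

  private
    hasWeight? : Decidable (λ t → ρ ⊕ ⟦ μ ⟧ ⊕ content (ν ₃) t ≡ ρ ⊕ ⟦ lam ⟧)
    hasWeight? t = ρ ⊕ ⟦ μ ⟧ ⊕ content (ν ₃) t ≟ᵥ ρ ⊕ ⟦ lam ⟧

    dominant : List Pattern
    dominant = dominantPatterns (2 + μ ₁) (1 + μ ₂) (μ ₃) (ν ₁) (ν ₂) (ν ₃)

  lrPatterns : List Pattern
  lrPatterns = filter hasWeight? dominant

  lrPatterns-unique : Unique lrPatterns
  lrPatterns-unique =
    Uniqueₚ.filter⁺ hasWeight? (dominantPatterns-unique (2 + μ ₁) (1 + μ ₂) (μ ₃) (ν ₁) (ν ₂) (ν ₃))

  ∈-lrPatterns⁺ : ∀ {t} → IsLRPattern t → t ∈ lrPatterns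
  ∈-lrPatterns⁺ (t-dominant , t-weight) = ∈-filter⁺ hasWeight? (∈-dominantPatterns⁺ t-dominant) t-weight

  ∈-lrPatterns⁻ : ∀ {t} → t ∈ lrPatterns → IsLRPattern t
  ∈-lrPatterns⁻ t∈ with t∈dominant , t-weight ← ∈-filter⁻ hasWeight? {xs = dominant} t∈ =
    ∈-dominantPatterns⁻ t∈dominant , t-weight

  lrCoefficient-count : ∀ {c} → ℓ lam ≤ 3 → ℓ μ ≤ 3 → ℓ ν ≤ 3 → IsLRCoefficient lam μ ν c →
    c ≡ ∑[ _ ∈ lrPatterns ] 1ℤ
  lrCoefficient-count {c} lam≤3 μ≤3 ν≤3 c-lr = begin
    c
      ≡⟨ lrCoefficient-pairing lam μ ν lam≤3 μ≤3 ν≤3 c-lr ⟩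
    (∑[ m ∈ schur 3 ν ] extract lam (ρ ⊕ ⟦ μ ⟧ ⊕ m))
      ≡⟨ ∑-schur-patterns ν ν≤3 (λ m → extract lam (ρ ⊕ ⟦ μ ⟧ ⊕ m)) ⟩
    (∑[ t ∈ patterns (ν ₁) (ν ₂) (ν ₃) ] extract lam (ρ ⊕ ⟦ μ ⟧ ⊕ content (ν ₃) t))
      ≡⟨ lr-rule (extract-alternating lam) (<⇒≤ (proj₁ ρ⊕⟦ μ ⟧-decreasing))
           (<⇒≤ (proj₂ ρ⊕⟦ μ ⟧-decreasing)) (ν ₁) (ν ₂) (ν ₃) ⟩
    (∑[ t ∈ dominant ] extract lam (ρ ⊕ ⟦ μ ⟧ ⊕ content (ν ₃) t))
      ≡⟨ ∑-cong-∈ dominant (λ t∈ →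
           extract-decreasing lam _ (dominantPattern-decreasing (∈-dominantPatterns⁻ t∈))) ⟩
    (∑[ t ∈ dominant ] 𝟙 (hasWeight? t))
      ≡⟨ ∑-𝟙 hasWeight? dominant ⟩
    (∑[ _ ∈ lrPatterns ] 1ℤ) ∎

  lrCoefficient≡1⇔∃!-lrPattern : ∀ {c} → ℓ lam ≤ 3 → ℓ μ ≤ 3 → ℓ ν ≤ 3 → IsLRCoefficient lam μ ν c →
    (c ≡ + 1) ⇔ ∃! _≡_ IsLRPattern
  lrCoefficient≡1⇔∃!-lrPattern {c} lam≤3 μ≤3 ν≤3 c-lr = mk⇔
    (λ c≡1 → ∃!-cong ∈-lrPatterns⁻ ∈-lrPatterns⁺ (Equivalence.to ∑-1≡1 (trans (sym c≡∑) c≡1)))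
    (λ ∃!t → trans c≡∑ (Equivalence.from ∑-1≡1 (∃!-cong ∈-lrPatterns⁺ ∈-lrPatterns⁻ ∃!t)))
    where
    c≡∑ : c ≡ ∑[ _ ∈ lrPatterns ] 1ℤ
    c≡∑ = lrCoefficient-count lam≤3 μ≤3 ν≤3 c-lr
    ∑-1≡1 : (∑[ _ ∈ lrPatterns ] 1ℤ ≡ 1ℤ) ⇔ ∃! _≡_ (_∈ lrPatterns)
    ∑-1≡1 = ∑-1≡1⇔∃! lrPatterns-unique

-- Littlewood–Richardson patterns as integers in an interval

module _ {m n} (lower : Vec ℤ m) (upper : Vec ℤ n) where

  Between : ℤ → Set
  Between x = (∀ i → lookup lower i ℤ.≤ x) × (∀ j → x ℤ.≤ lookup upper j)

  Degenerate : Set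
  Degenerate =
    (∀ j i → lookup lower i ℤ.≤ lookup upper j) × (∃[ j ] ∃[ i ] lookup lower i ≡ lookup upper j)

  ∃!-between⇔degenerate : ∃! _≡_ Between ⇔ Degenerate
  ∃!-between⇔degenerate = mk⇔ to from
    where
    i≢pred[i] : ∀ {i} → i ≢ ℤ.pred i
    i≢pred[i] {i} i≡pred[i] = ℤₚ.i≢suc[i] (trans (sym i≡pred[i]) (sym (ℤₚ.suc-pred i)))
    to : ∃! _≡_ Between → Degenerate
    to (x , (lower≤x , x≤upper) , x≡)
      with i , lower≮x ← Finₚ.¬∀⟶∃¬ m _ (λ i → lookup lower i ℤₚ.<? x) (λ lower<x → i≢pred[i]
             (x≡ ((λ i → ℤₚ.i<j⇒i≤pred[j] (lower<x i)) , λ j → ℤₚ.i≤j⇒pred[i]≤j (x≤upper j))))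
         | j , x≮upper ← Finₚ.¬∀⟶∃¬ n _ (λ j → x ℤₚ.<? lookup upper j) (λ x<upper → ℤₚ.i≢suc[i]
             (x≡ ((λ i → ℤₚ.i≤j⇒i≤1+j (lower≤x i)) , λ j → ℤₚ.i<j⇒suc[i]≤j (x<upper j)))) =
        (λ j i → ℤₚ.≤-trans (lower≤x i) (x≤upper j))
      , j , i , trans (ℤₚ.≤-antisym (lower≤x i) (ℤₚ.≮⇒≥ lower≮x))
                      (ℤₚ.≤-antisym (x≤upper j) (ℤₚ.≮⇒≥ x≮upper))
    from : Degenerate → ∃! _≡_ Between
    from (lower≤upper , j , i , lower≡upper) =
        lookup upper j
      , (lower≤upper j , λ j′ → subst (ℤ._≤ lookup upper j′) lower≡upper (lower≤upper j′ i))
      , λ (lower≤y , y≤upper) → ℤₚ.≤-antisym (subst (ℤ._≤ _) lower≡upper (lower≤y i)) (y≤upper j)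

Triple Quintuple : Set
Triple = ℤ × ℤ × ℤ
Quintuple = ℤ × ℤ × ℤ × ℤ × ℤ

HasShapeAndWeight : (l m n : Triple) → Quintuple → Set
HasShapeAndWeight (l₁ , l₂ , l₃) (m₁ , m₂ , m₃) (n₁ , n₂ , n₃) (a , b , c , d , e) =
  a ℤ.+ b ℤ.+ c ≡ n₁ × d ℤ.+ e ≡ n₂ ×
  m₁ ℤ.+ a ≡ l₁ × m₂ ℤ.+ (b ℤ.+ d) ≡ l₂ × m₃ ℤ.+ (c ℤ.+ (e ℤ.+ n₃)) ≡ l₃

BalancedTriples : (l m n : Triple) → Set
BalancedTriples (l₁ , l₂ , l₃) (m₁ , m₂ , m₃) (n₁ , n₂ , n₃) =
  l₁ ℤ.+ l₂ ℤ.+ l₃ ≡ m₁ ℤ.+ m₂ ℤ.+ m₃ ℤ.+ (n₁ ℤ.+ n₂ ℤ.+ n₃)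

shapeAndWeight⇒balanced : ∀ l m n t → HasShapeAndWeight l m n t → BalancedTriples l m n
shapeAndWeight⇒balanced _ (m₁ , m₂ , m₃) (_ , _ , n₃) (a , b , c , d , e)
                        (refl , refl , refl , refl , refl) =
  ℤ-Ring.solve vars
  where
  vars : List ℤ
  vars = m₁ ∷ m₂ ∷ m₃ ∷ n₃ ∷ a ∷ b ∷ c ∷ d ∷ e ∷ []

-- A pattern t of given shape and weight is determined by d, and the inequalities which make t an
-- LR pattern, namely the nonnegativity of lowerSlacks t and upperSlacks t, bound d from both sides.
lowerBounds : (l m n : Triple) → Vec ℤ 3
lowerBounds (l₁ , l₂ , l₃) (m₁ , m₂ , m₃) (n₁ , n₂ , n₃) =
    l₁ ℤ.+ l₂ ℤ.- m₁ ℤ.- m₂ ℤ.- n₁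
  ∷ n₃
  ∷ l₂ ℤ.- m₁
  ∷ []

lowerSlacks : (m n : Triple) → Quintuple → Vec ℤ 3
lowerSlacks (m₁ , m₂ , m₃) (n₁ , n₂ , n₃) (a , b , c , d , e) =
    c
  ∷ d ℤ.- n₃
  ∷ m₁ ℤ.- (m₂ ℤ.+ b)
  ∷ []

upperBounds : (l m n : Triple) → Vec ℤ 6
upperBounds (l₁ , l₂ , l₃) (m₁ , m₂ , m₃) (n₁ , n₂ , n₃) =
    l₂ ℤ.- m₂
  ∷ n₂
  ∷ l₁ ℤ.- m₁
  ∷ l₁ ℤ.+ l₂ ℤ.- m₁ ℤ.- m₂ ℤ.- n₂
  ∷ l₁ ℤ.+ l₂ ℤ.- m₁ ℤ.- m₃ ℤ.- n₁
  ∷ l₂ ℤ.- l₃ ℤ.+ n₃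
  ∷ []

upperSlacks : (m n : Triple) → Quintuple → Vec ℤ 6
upperSlacks (m₁ , m₂ , m₃) (n₁ , n₂ , n₃) (a , b , c , d , e) =
    b
  ∷ e
  ∷ a ℤ.- d
  ∷ a ℤ.+ b ℤ.- n₂
  ∷ m₂ ℤ.- (m₃ ℤ.+ c)
  ∷ m₂ ℤ.+ b ℤ.- (m₃ ℤ.+ (c ℤ.+ e))
  ∷ []

lower-slack : ∀ l m n (t@(_ , _ , _ , d , _) : Quintuple) → HasShapeAndWeight l m n t →
  VecPointwise.Pointwise (λ bound slack → d ℤ.- bound ≡ slack) (lowerBounds l m n) (lowerSlacks m n t)
lower-slack _ (m₁ , m₂ , m₃) (_ , _ , n₃) (a , b , c , d , e) (refl , refl , refl , refl , refl) =
  ℤ-Ring.solve vars ∷ ℤ-Ring.solve vars ∷ ℤ-Ring.solve vars ∷ []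
  where
  vars : List ℤ
  vars = m₁ ∷ m₂ ∷ m₃ ∷ n₃ ∷ a ∷ b ∷ c ∷ d ∷ e ∷ []

upper-slack : ∀ l m n (t@(_ , _ , _ , d , _) : Quintuple) → HasShapeAndWeight l m n t →
  VecPointwise.Pointwise (λ bound slack → bound ℤ.- d ≡ slack) (upperBounds l m n) (upperSlacks m n t)
upper-slack _ (m₁ , m₂ , m₃) (_ , _ , n₃) (a , b , c , d , e) (refl , refl , refl , refl , refl) =
  ℤ-Ring.solve vars ∷ ℤ-Ring.solve vars ∷ ℤ-Ring.solve vars ∷
  ℤ-Ring.solve vars ∷ ℤ-Ring.solve vars ∷ ℤ-Ring.solve vars ∷ []
  where
  vars : List ℤ
  vars = m₁ ∷ m₂ ∷ m₃ ∷ n₃ ∷ a ∷ b ∷ c ∷ d ∷ e ∷ []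

Nonnegative : Vec ℤ n → Set
Nonnegative v = ∀ i → 0ℤ ℤ.≤ lookup v i

between⇔nonnegative : ∀ l m n (t@(_ , _ , _ , d , _) : Quintuple) → HasShapeAndWeight l m n t →
  Between (lowerBounds l m n) (upperBounds l m n) d ⇔
  (Nonnegative (lowerSlacks m n t) × Nonnegative (upperSlacks m n t))
between⇔nonnegative l m n t@(_ , _ , _ , d , _) t-solution = mk⇔
  (λ (lower≤d , d≤upper) →
      (λ i → subst (0ℤ ℤ.≤_) (VecPointwise.lookup lower≡ i) (ℤₚ.i≤j⇒0≤j-i (lower≤d i)))
    , (λ j → subst (0ℤ ℤ.≤_) (VecPointwise.lookup upper≡ j) (ℤₚ.i≤j⇒0≤j-i (d≤upper j))))
  (λ (0≤lower , 0≤upper) →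
      (λ i → ℤₚ.0≤i-j⇒j≤i (subst (0ℤ ℤ.≤_) (sym (VecPointwise.lookup lower≡ i)) (0≤lower i)))
    , (λ j → ℤₚ.0≤i-j⇒j≤i (subst (0ℤ ℤ.≤_) (sym (VecPointwise.lookup upper≡ j)) (0≤upper j))))
  where
  lower≡ : VecPointwise.Pointwise (λ bound slack → d ℤ.- bound ≡ slack)
                                  (lowerBounds l m n) (lowerSlacks m n t)
  lower≡ = lower-slack l m n t t-solution
  upper≡ : VecPointwise.Pointwise (λ bound slack → bound ℤ.- d ≡ slack)
                                  (upperBounds l m n) (upperSlacks m n t)
  upper≡ = upper-slack l m n t t-solution

i+j+k≡s⇒k≡s-[i+j] : ∀ i j k {s} → i ℤ.+ j ℤ.+ k ≡ s → k ≡ s ℤ.- (i ℤ.+ j)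
i+j+k≡s⇒k≡s-[i+j] i j k refl = cancel i j k
  where
  cancel : ∀ i j k → k ≡ i ℤ.+ j ℤ.+ k ℤ.- (i ℤ.+ j)
  cancel = ℤ-Ring.solve-∀

shapeAndWeight-solution :
  ∀ (l@(l₁ , l₂ , _) m@(m₁ , m₂ , _) n@(n₁ , n₂ , _) : Triple) d → BalancedTriples l m n →
  HasShapeAndWeight l m n
    (l₁ ℤ.- m₁ , l₂ ℤ.- m₂ ℤ.- d , d ℤ.- (l₁ ℤ.+ l₂ ℤ.- m₁ ℤ.- m₂ ℤ.- n₁) , d , n₂ ℤ.- d)
shapeAndWeight-solution (l₁ , l₂ , l₃) (m₁ , m₂ , m₃) (n₁ , n₂ , n₃) d balanced
  with refl ← i+j+k≡s⇒k≡s-[i+j] l₁ l₂ l₃ balanced =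
  ℤ-Ring.solve vars , ℤ-Ring.solve vars , ℤ-Ring.solve vars , ℤ-Ring.solve vars , ℤ-Ring.solve vars
  where
  vars : List ℤ
  vars = l₁ ∷ l₂ ∷ m₁ ∷ m₂ ∷ m₃ ∷ n₁ ∷ n₂ ∷ n₃ ∷ d ∷ []

quintuple : Pattern → Quintuple
quintuple (a , b , c , d , e) = + a , + b , + c , + d , + e

twos₂ : Pattern → ℕ
twos₂ (_ , _ , _ , d , _) = d

0≤i⇒∃+ : ∀ {i} → 0ℤ ℤ.≤ i → ∃[ k ] i ≡ + k
0≤i⇒∃+ (+≤+ {n = k} _) = k , refl

between⇒shapeAndWeight : ∀ (l m n@(_ , _ , n₃) : Triple) {x} → BalancedTriples l m n → 0ℤ ℤ.≤ n₃ →
  Between (lowerBounds l m n) (upperBounds l m n) x →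
  ∃[ t ] x ≡ + twos₂ t × HasShapeAndWeight l m n (quintuple t)
between⇒shapeAndWeight l m n {x} balanced 0≤n₃ (lower≤x , x≤upper)
  with solution ← shapeAndWeight-solution l m n x balanced
  with d , refl ← 0≤i⇒∃+ (ℤₚ.≤-trans 0≤n₃ (lower≤x 1F))
  with a , a≡ ← 0≤i⇒∃+ (ℤₚ.≤-trans (+≤+ z≤n) (x≤upper 2F))
     | b , b≡ ← 0≤i⇒∃+ (ℤₚ.i≤j⇒0≤j-i (x≤upper 0F))
     | c , c≡ ← 0≤i⇒∃+ (ℤₚ.i≤j⇒0≤j-i (lower≤x 0F))
     | e , e≡ ← 0≤i⇒∃+ (ℤₚ.i≤j⇒0≤j-i (x≤upper 1F))
  rewrite a≡ | b≡ | c≡ | e≡ = (a , b , c , d , e) , refl , solution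

Balanced : (lam μ ν : Partition) → Set
Balanced lam μ ν = ∣ lam ∣₃ ≡ ∣ μ ∣₃ + ∣ ν ∣₃

triple : Partition → Triple
triple κ = + κ ₁ , + κ ₂ , + κ ₃

≤⇔0≤- : ∀ {m n} → m ≤ n ⇔ 0ℤ ℤ.≤ + n ℤ.- + m
≤⇔0≤- = mk⇔ (λ m≤n → ℤₚ.i≤j⇒0≤j-i (+≤+ m≤n)) (λ 0≤n-m → ℤₚ.drop‿+≤+ (ℤₚ.0≤i-j⇒j≤i 0≤n-m))

module _ (lam μ ν : Partition) where

  dLowerBounds : Vec ℤ 3
  dLowerBounds = lowerBounds (triple lam) (triple μ) (triple ν)

  dUpperBounds : Vec ℤ 6
  dUpperBounds = upperBounds (triple lam) (triple μ) (triple ν)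

  lrPattern⇒shapeAndWeight : ∀ {t} → IsLRPattern lam μ ν t →
    HasShapeAndWeight (triple lam) (triple μ) (triple ν) (quintuple t)
  lrPattern⇒shapeAndWeight (((row₁ , row₂ , _) , _) , t-weight) =
      cong +_ row₁
    , cong +_ row₂
    , cong (λ v → + (lookup v 0F ∸ 2)) t-weight
    , cong (λ v → + (lookup v 1F ∸ 1)) t-weight
    , cong (λ v → + lookup v 2F) t-weight

  lrPattern⇒balanced : ∀ {t} → IsLRPattern lam μ ν t → Balanced lam μ ν
  lrPattern⇒balanced {t} t-lr =
    ℤₚ.+-injective (shapeAndWeight⇒balanced (triple lam) (triple μ) (triple ν) (quintuple t)
                      (lrPattern⇒shapeAndWeight t-lr))

  lrPattern⇒between : ∀ {t} → IsLRPattern lam μ ν t → Between dLowerBounds dUpperBounds (+ twos₂ t)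
  lrPattern⇒between {t} t-lr@((t-pattern@(_ , _ , ν₂≤a+b , _ , ν₃≤d) , c-fits , b-fits , e-fits) , _) =
    Equivalence.from (between⇔nonnegative (triple lam) (triple μ) (triple ν) (quintuple t)
                        (lrPattern⇒shapeAndWeight t-lr))
      ((λ { 0F → +≤+ z≤n
          ; 1F → Equivalence.to ≤⇔0≤- ν₃≤d
          ; 2F → Equivalence.to ≤⇔0≤- (s≤s⁻¹ (s≤s⁻¹ b-fits)) })
      , λ { 0F → +≤+ z≤n
          ; 1F → +≤+ z≤n
          ; 2F → Equivalence.to ≤⇔0≤- (isPattern⇒d≤a t t-pattern)
          ; 3F → Equivalence.to ≤⇔0≤- ν₂≤a+b
          ; 4F → Equivalence.to ≤⇔0≤- (s≤s⁻¹ c-fits)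
          ; 5F → Equivalence.to ≤⇔0≤- (s≤s⁻¹ e-fits) })

  between⇒lrPattern : Balanced lam μ ν → ∀ {x} → Between dLowerBounds dUpperBounds x →
                      ∃[ t ] x ≡ + twos₂ t × IsLRPattern lam μ ν t
  between⇒lrPattern balanced x-between
    with t@(a , b , c , d , e) , refl , t-solution@(row₁ , row₂ , weight₁ , weight₂ , weight₃) ←
           between⇒shapeAndWeight (triple lam) (triple μ) (triple ν)
             (cong +_ balanced) (+≤+ z≤n) x-between
    with 0≤lower , 0≤upper ←
           Equivalence.to
             (between⇔nonnegative (triple lam) (triple μ) (triple ν) (quintuple t) t-solution)
             x-between =
      t , refl
    , ( ( ℤₚ.+-injective row₁ , ℤₚ.+-injective row₂ , fromSlack (0≤upper 3F)
        , subst (_≤ a + e) (ℤₚ.+-injective row₂) (+-monoˡ-≤ e (fromSlack (0≤upper 2F)))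
        , fromSlack (0≤lower 1F))
      , s≤s (fromSlack (0≤upper 4F)) , s≤s (s≤s (fromSlack (0≤lower 2F)))
      , s≤s (fromSlack (0≤upper 5F)))
    , ⟨⟩-cong (cong (_+_ 2) (ℤₚ.+-injective weight₁)) (cong (_+_ 1) (ℤₚ.+-injective weight₂))
              (ℤₚ.+-injective weight₃)
    where
    fromSlack : ∀ {m n} → 0ℤ ℤ.≤ + n ℤ.- + m → m ≤ n
    fromSlack = Equivalence.from ≤⇔0≤-

  lrPattern-determined : ∀ {t t′} → IsLRPattern lam μ ν t → IsLRPattern lam μ ν t′ →
                         twos₂ t ≡ twos₂ t′ → t ≡ t′
  lrPattern-determined {a , b , c , d , e} {a′ , b′ , c′ , d , e′} t-lr t′-lr refl
    with row₁ , row₂ , weight₁ , weight₂ , _ ← lrPattern⇒shapeAndWeight t-lr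
       | row₁′ , row₂′ , weight₁′ , weight₂′ , _ ← lrPattern⇒shapeAndWeight t′-lr
    with refl ← +-cancelˡ-≡ (μ ₁) a a′ (ℤₚ.+-injective (trans weight₁ (sym weight₁′)))
       | refl ← +-cancelʳ-≡ d b b′
                  (+-cancelˡ-≡ (μ ₂) (b + d) (b′ + d) (ℤₚ.+-injective (trans weight₂ (sym weight₂′))))
    with refl ← +-cancelˡ-≡ (a + b) c c′ (ℤₚ.+-injective (trans row₁ (sym row₁′)))
       | refl ← +-cancelˡ-≡ d e e′ (ℤₚ.+-injective (trans row₂ (sym row₂′))) = refl

  ∃!-lrPattern⇔∃!-between :
    ∃! _≡_ (IsLRPattern lam μ ν) ⇔ (Balanced lam μ ν × ∃! _≡_ (Between dLowerBounds dUpperBounds))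
  ∃!-lrPattern⇔∃!-between = mk⇔ to from
    where
    to : ∃! _≡_ (IsLRPattern lam μ ν) →
         Balanced lam μ ν × ∃! _≡_ (Between dLowerBounds dUpperBounds)
    to (t , t-lr , t≡) = lrPattern⇒balanced t-lr , + twos₂ t , lrPattern⇒between t-lr , λ x-between →
      let t′ , x≡ , t′-lr = between⇒lrPattern (lrPattern⇒balanced t-lr) x-between
      in trans (cong (+_ ∘ twos₂) (t≡ t′-lr)) (sym x≡)
    from : Balanced lam μ ν × ∃! _≡_ (Between dLowerBounds dUpperBounds) →
           ∃! _≡_ (IsLRPattern lam μ ν)
    from (balanced , x , x-between , x≡) =
      let t , x≡t , t-lr = between⇒lrPattern balanced x-between
      in t , t-lr , λ t′-lr → lrPattern-determined t-lr t′-lr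
           (ℤₚ.+-injective (trans (sym x≡t) (x≡ (lrPattern⇒between t′-lr))))

-- The Horn inequalities

-- The difference of the two sides of the k-th Horn inequality is that of the two bounds for d which
-- appear in the k-th entry.
hornPairs : (A → B → C) → Vec A 6 → Vec B 3 → List C
hornPairs _∙_ (U₀ ∷ U₁ ∷ U₂ ∷ U₃ ∷ U₄ ∷ U₅ ∷ []) (L₀ ∷ L₁ ∷ L₂ ∷ []) =
    U₄ ∙ L₀ ∷ U₀ ∙ L₂ ∷ U₁ ∙ L₁ ∷ U₃ ∙ L₀ ∷ U₅ ∙ L₁ ∷ U₂ ∙ L₂
  ∷ U₀ ∙ L₀ ∷ U₁ ∙ L₂ ∷ U₂ ∙ L₀ ∷ U₅ ∙ L₂ ∷ U₄ ∙ L₁ ∷ U₃ ∙ L₁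
  ∷ U₁ ∙ L₀ ∷ U₅ ∙ L₀ ∷ U₀ ∙ L₁ ∷ U₄ ∙ L₂ ∷ U₃ ∙ L₂ ∷ U₂ ∙ L₁
  ∷ []

hornIndices : List (Fin 6 × Fin 3)
hornIndices = hornPairs _,_ (Vec.allFin 6) (Vec.allFin 3)

∈-hornIndices : ∀ j i → (j , i) ∈ hornIndices
∈-hornIndices = from-yes (Finₚ.all? λ j → Finₚ.all? λ i → (j , i) ∈? hornIndices)
  where open DecMembership (Productₚ.≡-dec Fin._≟_ Fin._≟_) using (_∈?_)

hornPairs-lookup : ∀ (_∙_ : A → B → C) us ls →
  hornPairs _∙_ us ls ≡ map (λ (j , i) → lookup us j ∙ lookup ls i) hornIndices
hornPairs-lookup _∙_ (_ ∷ _ ∷ _ ∷ _ ∷ _ ∷ _ ∷ []) (_ ∷ _ ∷ _ ∷ []) = refl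

module _ (_∙_ : A → B → C) (us : Vec A 6) (ls : Vec B 3) where

  private
    entry : Fin 6 × Fin 3 → C
    entry (j , i) = lookup us j ∙ lookup ls i

    hornPairs≡ : hornPairs _∙_ us ls ≡ map entry hornIndices
    hornPairs≡ = hornPairs-lookup _∙_ us ls

  All-hornPairs : All P (hornPairs _∙_ us ls) ⇔ (∀ j i → P (lookup us j ∙ lookup ls i))
  All-hornPairs {P = P} = mk⇔
    (λ all j i → All.lookup (Allₚ.map⁻ {f = entry} (subst (All P) hornPairs≡ all)) (∈-hornIndices j i))
    (λ all → subst (All P) (sym hornPairs≡)
               (Allₚ.map⁺ {f = entry} (All.universal (λ (j , i) → all j i) hornIndices)))

  Any-hornPairs : Any P (hornPairs _∙_ us ls) ⇔ (∃[ j ] ∃[ i ] P (lookup us j ∙ lookup ls i))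
  Any-hornPairs {P = P} = mk⇔
    (λ any → let (j , i) , p = Any.satisfied (Anyₚ.map⁻ {f = entry} {xs = hornIndices}
                                                (subst (Any P) hornPairs≡ any))
             in j , i , p)
    (λ (j , i , p) → subst (Any P) (sym hornPairs≡)
                       (Anyₚ.map⁺ {f = entry} (lose (∈-hornIndices j i) p)))

slack : ℕ × ℕ → ℤ
slack (x , y) = + y ℤ.- + x

balanced⇒hornSlacks : ∀ lam μ ν → Balanced lam μ ν →
  map slack (hornInequalities lam μ ν) ≡ hornPairs ℤ._-_ (dUpperBounds lam μ ν) (dLowerBounds lam μ ν)
balanced⇒hornSlacks lam μ ν balanced =
  Pointwise.Pointwise-≡⇒≡ (differences (triple lam) (triple μ) (triple ν) (cong +_ balanced))
  where
  differences :
    ∀ (l@(l₁ , l₂ , l₃) m@(m₁ , m₂ , m₃) n@(n₁ , n₂ , n₃) : Triple) → BalancedTriples l m n →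
    Pointwise _≡_
      ( m₂ ℤ.- m₃ ∷ m₁ ℤ.- m₂ ∷ n₂ ℤ.- n₃ ∷ n₁ ℤ.- n₂ ∷ l₂ ℤ.- l₃ ∷ l₁ ℤ.- l₂
      ∷ m₁ ℤ.+ n₁ ℤ.- l₁ ∷ m₁ ℤ.+ n₂ ℤ.- l₂ ∷ m₂ ℤ.+ n₁ ℤ.- l₂
      ∷ m₁ ℤ.+ n₃ ℤ.- l₃ ∷ m₂ ℤ.+ n₂ ℤ.- l₃ ∷ m₃ ℤ.+ n₁ ℤ.- l₃
      ∷ l₃ ℤ.- (m₃ ℤ.+ n₃) ∷ l₂ ℤ.- (m₃ ℤ.+ n₂) ∷ l₂ ℤ.- (m₂ ℤ.+ n₃)
      ∷ l₁ ℤ.- (m₃ ℤ.+ n₁) ∷ l₁ ℤ.- (m₂ ℤ.+ n₂) ∷ l₁ ℤ.- (m₁ ℤ.+ n₃) ∷ [])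
      (hornPairs ℤ._-_ (upperBounds l m n) (lowerBounds l m n))
  differences (l₁ , l₂ , l₃) (m₁ , m₂ , m₃) (n₁ , n₂ , n₃) balanced
    with refl ← i+j+k≡s⇒k≡s-[i+j] l₁ l₂ l₃ balanced =
    ℤ-Ring.solve vars ∷ ℤ-Ring.solve vars ∷ ℤ-Ring.solve vars ∷ ℤ-Ring.solve vars ∷ ℤ-Ring.solve vars ∷
    ℤ-Ring.solve vars ∷ ℤ-Ring.solve vars ∷ ℤ-Ring.solve vars ∷ ℤ-Ring.solve vars ∷ ℤ-Ring.solve vars ∷
    ℤ-Ring.solve vars ∷ ℤ-Ring.solve vars ∷ ℤ-Ring.solve vars ∷ ℤ-Ring.solve vars ∷ ℤ-Ring.solve vars ∷
    ℤ-Ring.solve vars ∷ ℤ-Ring.solve vars ∷ ℤ-Ring.solve vars ∷ []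
    where
    vars : List ℤ
    vars = l₁ ∷ l₂ ∷ m₁ ∷ m₂ ∷ m₃ ∷ n₁ ∷ n₂ ∷ n₃ ∷ []

module _ (lam μ ν : Partition) (balanced : Balanced lam μ ν) where

  private
    lower : Vec ℤ 3
    lower = dLowerBounds lam μ ν

    upper : Vec ℤ 6
    upper = dUpperBounds lam μ ν

    slacks≡ : map slack (hornInequalities lam μ ν) ≡ hornPairs ℤ._-_ upper lower
    slacks≡ = balanced⇒hornSlacks lam μ ν balanced

  hornInequalities⇔lower≤upper :
    All (uncurry _≤_) (hornInequalities lam μ ν) ⇔ (∀ j i → lookup lower i ℤ.≤ lookup upper j)
  hornInequalities⇔lower≤upper = mk⇔ to from
    where
    to : All (uncurry _≤_) (hornInequalities lam μ ν) → ∀ j i → lookup lower i ℤ.≤ lookup upper j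
    to horn j i = ℤₚ.0≤i-j⇒j≤i (Equivalence.to (All-hornPairs ℤ._-_ upper lower)
      (subst (All (0ℤ ℤ.≤_)) slacks≡ (Allₚ.map⁺ (All.map (Equivalence.to ≤⇔0≤-) horn))) j i)
    from : (∀ j i → lookup lower i ℤ.≤ lookup upper j) → All (uncurry _≤_) (hornInequalities lam μ ν)
    from lower≤upper = All.map (Equivalence.from ≤⇔0≤-) (Allₚ.map⁻ (subst (All (0ℤ ℤ.≤_)) (sym slacks≡)
      (Equivalence.from (All-hornPairs ℤ._-_ upper lower) λ j i → ℤₚ.i≤j⇒0≤j-i (lower≤upper j i))))

  hornEquality⇔lower≡upper :
    Any (uncurry _≡_) (hornInequalities lam μ ν) ⇔ (∃[ j ] ∃[ i ] lookup lower i ≡ lookup upper j)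
  hornEquality⇔lower≡upper = mk⇔ to from
    where
    to : Any (uncurry _≡_) (hornInequalities lam μ ν) → ∃[ j ] ∃[ i ] lookup lower i ≡ lookup upper j
    to facet
      with j , i , U-L≡0 ← Equivalence.to (Any-hornPairs ℤ._-_ upper lower) (subst (Any (_≡ 0ℤ)) slacks≡
             (Anyₚ.map⁺ (Any.map (λ x≡y → ℤₚ.i≡j⇒i-j≡0 (cong +_ (sym x≡y))) facet))) =
      j , i , sym (ℤₚ.i-j≡0⇒i≡j _ _ U-L≡0)
    from : (∃[ j ] ∃[ i ] lookup lower i ≡ lookup upper j) → Any (uncurry _≡_) (hornInequalities lam μ ν)
    from (j , i , L≡U) = Any.map (λ y-x≡0 → sym (ℤₚ.+-injective (ℤₚ.i-j≡0⇒i≡j _ _ y-x≡0)))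
      (Anyₚ.map⁻ (subst (Any (_≡ 0ℤ)) (sym slacks≡)
        (Equivalence.from (Any-hornPairs ℤ._-_ upper lower) (j , i , ℤₚ.i≡j⇒i-j≡0 (sym L≡U)))))

balanced×degenerate⇔onFacet : ∀ lam μ ν →
  (Balanced lam μ ν × Degenerate (dLowerBounds lam μ ν) (dUpperBounds lam μ ν)) ⇔ OnFacet lam μ ν
balanced×degenerate⇔onFacet lam μ ν = mk⇔
  (λ (balanced , lower≤upper , lower≡upper) →
      (balanced , Equivalence.from (hornInequalities⇔lower≤upper lam μ ν balanced) lower≤upper)
    , Equivalence.from (hornEquality⇔lower≡upper lam μ ν balanced) lower≡upper)
  (λ ((balanced , horn) , facet) →
      balanced
    , Equivalence.to (hornInequalities⇔lower≤upper lam μ ν balanced) horn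
    , Equivalence.to (hornEquality⇔lower≡upper lam μ ν balanced) facet)

theorem3p1 : (lam μ ν : Partition) → ℓ lam ≤ 3 → ℓ μ ≤ 3 → ℓ ν ≤ 3 →
  (c : ℤ) → IsLRCoefficient lam μ ν c →
  (c ≡ + 1) ⇔ OnFacet lam μ ν
theorem3p1 lam μ ν lam≤3 μ≤3 ν≤3 c c-lr =
  c ≡ + 1
    Equiv.∼⟨ lrCoefficient≡1⇔∃!-lrPattern lam μ ν lam≤3 μ≤3 ν≤3 c-lr ⟩
  ∃! _≡_ (IsLRPattern lam μ ν)
    Equiv.∼⟨ ∃!-lrPattern⇔∃!-between lam μ ν ⟩
  (Balanced lam μ ν × ∃! _≡_ (Between lower upper))
    Equiv.∼⟨ ⇔-id (Balanced lam μ ν) ×-⇔ ∃!-between⇔degenerate lower upper ⟩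
  (Balanced lam μ ν × Degenerate lower upper)
    Equiv.∼⟨ balanced×degenerate⇔onFacet lam μ ν ⟩
  OnFacet lam μ ν Equiv.∎
  where
  module Equiv = Related.EquationalReasoning {k = Related.equivalence}
  lower : Vec ℤ 3
  lower = dLowerBounds lam μ ν
  upper : Vec ℤ 6
  upper = dUpperBounds lam μ ν
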